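{- Let $n\ge d$ be positive integers, $L=\{\ell_1,\dots,\ell_n\}$, $R=\{r_1,\dots,r_d\}$, and let $\mathcal M$ be a linkage $(n,d)$-matching field on $L\sqcup R$. For every $v\in\mathbb Z_{>0}^d$ with $\sum_i v_i=n$ there exists a maximal tope with right degree vector $v$ that is compatible with every matching of $\mathcal M$. Moreover, it is the unique tope with right degree vector $v$ that is compatible with every matching of $\mathcal M$.
   Context: Bipartite graphs on $L\sqcup R$ are identified with edge sets. A tope is a bipartite graph whose left degree vector (degrees of $\ell_1,\dots,\ell_n$) is $e_\sigma$ for some $\sigma\subseteq L$ and whose right degree vector (degrees of $r_1,\dots,r_d$) has all entries positive; it is maximal if $\sigma=L$. Two forests on $L\sqcup R$ are compatible if, whenever both contain perfect matchings on the same $J\sqcup I$ ($J\subseteq L$, $I\subseteq R$), those matchings are equal. An $(n,d)$-matching field $\mathcal M=(M_\sigma)$ assigns to each $d$-subset $\sigma\subseteq L$ a perfect matching $M_\sigma$ on $\sigma\sqcup R$. It is linkage if for every $(d+1)$-subset $\tau\subseteq L$ the union of the matchings $M_\sigma$, $\sigma\subset\tau$, $|\sigma|=d$, is a tree on $\tau\sqcup R$. -}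

module Defs where

open import Data.Nat using (ℕ; zero; suc; _<_; _≤_)
open import Data.Bool using (Bool; true; false; if_then_else_)
open import Data.Fin using (Fin; zero; suc; inject₁; fromℕ)
open import Data.Fin.Subset using (Subset; _∈_; _⊆_; ∣_∣; ⊤)
open import Data.Vec using (tabulate; lookup)
open import Data.Vec.Functional using (foldr)
open import Data.Sum using (_⊎_; inj₁; inj₂)
open import Data.Product using (Σ; ∃; _×_; _,_)
open import Function.Definitions using (Injective)
open import Relation.Binary.PropositionalEquality using (_≡_)
open import Relation.Binary.Construct.Closure.ReflexiveTransitive using (Star)
open import Relation.Nullary using (¬_)

-- Left vertices: Fin n (ℓ_1..ℓ_n); right vertices: Fin d (r_1..r_d).
-- A bipartite graph on L ⊔ R, identified with its edge set.
Graph : ℕ → ℕ → Set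
Graph n d = Fin n → Fin d → Bool

-- Edge relation of a graph (edge sets given as predicates, e.g. unions).
EdgeRel : ℕ → ℕ → Set₁
EdgeRel n d = Fin n → Fin d → Set

edges : ∀ {n d} → Graph n d → EdgeRel n d
edges G i j = G i j ≡ true

sumF : ∀ {d} → (Fin d → ℕ) → ℕ
sumF v = foldr Data.Nat._+_ 0 v

degL : ∀ {n d} → Graph n d → Fin n → ℕ
degL G i = ∣ tabulate (G i) ∣

degR : ∀ {n d} → Graph n d → Fin d → ℕ
degR G j = ∣ tabulate (λ i → G i j) ∣

indicator : ∀ {n} → Subset n → Fin n → ℕ
indicator σ i = if lookup σ i then 1 else 0

IsTopeOn : ∀ {n d} → Subset n → Graph n d → Set
IsTopeOn σ T = (∀ i → degL T i ≡ indicator σ i) × (∀ j → 0 < degR T j)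

IsTope : ∀ {n d} → Graph n d → Set
IsTope {n} T = Σ (Subset n) λ σ → IsTopeOn σ T

IsMaximalTope : ∀ {n d} → Graph n d → Set
IsMaximalTope T = IsTopeOn ⊤ T

_⊑_ : ∀ {n d} → Graph n d → Graph n d → Set
H ⊑ G = ∀ i j → H i j ≡ true → G i j ≡ true

IsPerfectMatchingOn : ∀ {n d} → Subset n → Subset d → Graph n d → Set
IsPerfectMatchingOn J I H =
  (∀ i j → H i j ≡ true → (i ∈ J) × (j ∈ I)) ×
  (∀ i → i ∈ J → degL H i ≡ 1) ×
  (∀ j → j ∈ I → degR H j ≡ 1)

Compatible : ∀ {n d} → Graph n d → Graph n d → Set
Compatible {n} {d} G₁ G₂ =
  ∀ (J : Subset n) (I : Subset d) (H₁ H₂ : Graph n d) →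
  H₁ ⊑ G₁ → IsPerfectMatchingOn J I H₁ →
  H₂ ⊑ G₂ → IsPerfectMatchingOn J I H₂ →
  ∀ i j → H₁ i j ≡ H₂ i j

-- (n,d)-matching field: a perfect matching on σ ⊔ R for each d-subset σ
-- (values at subsets of other sizes are irrelevant and never used).
record MatchingField (n d : ℕ) : Set where
  field
    M    : Subset n → Graph n d
    isPM : ∀ σ → ∣ σ ∣ ≡ d → IsPerfectMatchingOn σ ⊤ (M σ)
open MatchingField public

Vertex : ℕ → ℕ → Set
Vertex n d = Fin n ⊎ Fin d

data Adj {n d} (E : EdgeRel n d) : Vertex n d → Vertex n d → Set where
  lr : ∀ {i j} → E i j → Adj E (inj₁ i) (inj₂ j)
  rl : ∀ {i j} → E i j → Adj E (inj₂ j) (inj₁ i)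

InVerts : ∀ {n d} → Subset n → Vertex n d → Set
InVerts τ (inj₁ i) = i ∈ τ
InVerts τ (inj₂ j) = Data.Unit.⊤
  where import Data.Unit

-- a cycle ℓ₀ r₀ ℓ₁ r₁ … ℓ_{m+1} r_{m+1} ℓ₀ with distinct vertices (length ≥ 4)
HasCycle : ∀ {n d} → EdgeRel n d → Set
HasCycle {n} {d} E =
  Σ ℕ λ m → Σ (Fin (suc (suc m)) → Fin n) λ l → Σ (Fin (suc (suc m)) → Fin d) λ r →
    Injective _≡_ _≡_ l × Injective _≡_ _≡_ r ×
    (∀ t → E (l t) (r t)) ×
    (∀ (t : Fin (suc m)) → E (l (suc t)) (r (inject₁ t))) ×
    E (l zero) (r (fromℕ (suc m)))

IsTreeOn : ∀ {n d} → Subset n → EdgeRel n d → Set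
IsTreeOn τ E =
  (∀ i j → E i j → i ∈ τ) ×
  (∀ u v → InVerts τ u → InVerts τ v → Star (Adj E) u v) ×
  ¬ HasCycle E

IsLinkage : ∀ {n d} → MatchingField n d → Set
IsLinkage {n} {d} 𝓜 =
  ∀ (τ : Subset n) → ∣ τ ∣ ≡ suc d →
  IsTreeOn τ (λ i j → Σ (Subset n) λ σ → σ ⊆ τ × ∣ σ ∣ ≡ d × M 𝓜 σ i j ≡ true)

CompatibleWithAll : ∀ {n d} → MatchingField n d → Graph n d → Set
CompatibleWithAll {n} {d} 𝓜 T = ∀ (σ : Subset n) → ∣ σ ∣ ≡ d → Compatible T (M 𝓜 σ)

{-# OPTIONS --safe #-}
-- A linkage matching field is encoded by partial maps T from L to R ("assignments"), a tope being such
-- a T with prescribed domain and fibre sizes; it is good if M_σ = T|σ for every σ that meets each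
-- fibre once.  In a linkage field no two matchings, hence no two good topes, differ by a cycle, which
-- gives compatibility and uniqueness: two topes with the same fibre sizes differ by a union of cycles.
-- Existence is by induction on |v|.  Fix v and let T_x be the good tope of type v on τ - x, for x in τ.
-- The key invariant (for v = 1 it is the linkage axiom) is that the fibres of all T_x over a right
-- vertex r lie in a common set with only one element more.  It says that adding a suitable y to the
-- fibre of T_y over r yields a good tope on τ, so v_r can be increased, and it is inherited by the
-- larger type.
module Submission where

open import Defs
open import Data.Nat using (ℕ; zero; suc; pred; >-nonZero; _+_; _∸_; _≤_; _<_; z≤n; s≤s)
open import Data.Nat.Properties as ℕₚ using (≤-refl; <-irrefl; ≤-<-trans; n<1+n)
open import Data.Nat.Induction using (<-wellFounded)
open import Data.Bool using (Bool; true; false; if_then_else_)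
import Data.Bool.Properties as Bool
open import Data.Fin as Fin using (Fin; zero; suc; toℕ; inject₁; fromℕ; fromℕ<; opposite)
open import Data.Fin.Properties as Finₚ using (_≟_; any?; toℕ<n; toℕ-fromℕ<)
open import Data.Fin.Subset using (Subset; Nonempty; _∈_; _∉_; _⊆_; ∣_∣; ⊤; ⁅_⁆; _∪_; _-_; inside; outside)
open import Data.Fin.Subset.Properties
open import Data.Vec using (tabulate; lookup; _∷_; here; there)
open import Data.Vec.Functional using (updateAt)
open import Data.Vec.Functional.Properties using (updateAt-updates; updateAt-minimal)
open import Data.Vec.Properties using (lookup∘tabulate; lookup⇒[]=; []=⇒lookup; lookup-replicate)
open import Data.Maybe using (Maybe; just; nothing)
open import Data.Maybe.Properties using (just-injective; ≡-dec)
open import Data.Sum using (inj₁; inj₂)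
open import Data.Product using (Σ; ∃; ∃₂; _×_; _,_; proj₁; proj₂)
open import Data.Empty using (⊥; ⊥-elim)
open import Function using (_∘_; case_of_; mk⇔)
open import Function.Definitions using (Injective)
open import Induction.WellFounded using (Acc; acc)
open import Relation.Binary using (tri<; tri≈; tri>)
open import Relation.Binary.PropositionalEquality using (_≡_; _≢_; refl; sym; trans; cong; cong₂; subst)
open import Relation.Nullary using (¬_; Dec; yes; no; does; contradiction)
open import Relation.Nullary.Decidable using (_×-dec_; ¬?; dec-true; decidable-stable)
open import Relation.Unary using (Decidable)

-- The linkage axiom only sees `d`-subsets of a single `(d+1)`-subset, while two good topes can pick
-- out matchings on distant `d`-subsets. `exchange` bridges the gap: some vertex of `σ′` outside `σ`
-- has its `M_σ′`-edge in the linkage tree of `σ` with that vertex added, so `σ` can be moved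
-- towards `σ′` one vertex at a time. For `v = 1` each right vertex has degree 2 in the linkage tree
-- of `τ`, and passing from `T_x` to `T_y` rematches exactly the left vertices strictly between `x`
-- and `y` on the tree path. For larger types there is no tree at hand, but `Moves` still behaves
-- like such a path, and this is derived from the invariant and acyclicity alone. The hard part is
-- inheritance of the invariant. Erasing a vertex that several deletions share over the enlarged
-- fibre lowers their type. Two deletions always share one, but the invariant compares three;
-- `Triple` excludes the case where only pairs share.

-- Finite subsets, cardinalities and images.

comprehension : ∀ {n} {P : Fin n → Set} → Decidable P → Subset n
comprehension P? = tabulate (λ x → does (P? x))

∈-comprehension⁺ : ∀ {n} {P : Fin n → Set} (P? : Decidable P) {x} → P x → x ∈ comprehension P?
∈-comprehension⁺ P? {x} px =
  lookup⇒[]= x _ (trans (lookup∘tabulate _ x) (dec-true (P? x) px))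

∈-comprehension⁻ : ∀ {n} {P : Fin n → Set} (P? : Decidable P) {x} → x ∈ comprehension P? → P x
∈-comprehension⁻ P? {x} x∈ with P? x | trans (sym (lookup∘tabulate (λ y → does (P? y)) x)) ([]=⇒lookup x∈)
... | yes px | _ = px

∈-tabulate⁺ : ∀ {n} {f : Fin n → _} {x} → f x ≡ true → x ∈ tabulate f
∈-tabulate⁺ {f = f} {x} fx = lookup⇒[]= x _ (trans (lookup∘tabulate f x) fx)

∈-tabulate⁻ : ∀ {n} {f : Fin n → _} {x} → x ∈ tabulate f → f x ≡ true
∈-tabulate⁻ {f = f} {x} x∈ = trans (sym (lookup∘tabulate f x)) ([]=⇒lookup x∈)

x∉p-x : ∀ {n} (p : Subset n) x → x ∉ p - x
x∉p-x (_ ∷ p) (suc x) (there x∈) = x∉p-x p x x∈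
x∉p-x (inside ∷ p) zero ()
x∉p-x (outside ∷ p) zero ()

x∈p-y⇒x∈p : ∀ {n} {p : Subset n} {x y} → x ∈ p - y → x ∈ p
x∈p-y⇒x∈p {p = p} {y = y} = p─q⊆p p ⁅ y ⁆

x∈p-y⇒x≢y : ∀ {n} {p : Subset n} {x y} → x ∈ p - y → x ≢ y
x∈p-y⇒x≢y {p = p} {x} x∈ refl = x∉p-x p x x∈

x∈p⇒suc∣p-x∣≡∣p∣ : ∀ {n} {p : Subset n} {x} → x ∈ p → suc ∣ p - x ∣ ≡ ∣ p ∣
x∈p⇒suc∣p-x∣≡∣p∣ {p = inside ∷ p} here = cong (suc ∘ ∣_∣) (p─⊥≡p p)
x∈p⇒suc∣p-x∣≡∣p∣ {p = inside ∷ p} (there x∈) = cong suc (x∈p⇒suc∣p-x∣≡∣p∣ x∈)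
x∈p⇒suc∣p-x∣≡∣p∣ {p = outside ∷ p} (there x∈) = x∈p⇒suc∣p-x∣≡∣p∣ x∈

∣p-x∣≡ : ∀ {n} {p : Subset n} {x k} → x ∈ p → ∣ p ∣ ≡ suc k → ∣ p - x ∣ ≡ k
∣p-x∣≡ x∈ eq = ℕₚ.suc-injective (trans (x∈p⇒suc∣p-x∣≡∣p∣ x∈) eq)

x∈p∪x : ∀ {n} (p : Subset n) x → x ∈ p ∪ ⁅ x ⁆
x∈p∪x p x = q⊆p∪q p ⁅ x ⁆ (x∈⁅x⁆ x)

y∈p∪x∧y≢x⇒y∈p : ∀ {n} {p : Subset n} {x y} → y ∈ p ∪ ⁅ x ⁆ → y ≢ x → y ∈ p
y∈p∪x∧y≢x⇒y∈p {p = p} {x} y∈ y≢x with x∈p∪q⁻ p ⁅ x ⁆ y∈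
... | inj₁ y∈p = y∈p
... | inj₂ y∈x = contradiction (x∈⁅y⁆⇒x≡y x y∈x) y≢x

x∉p⇒p∪x-x≡p : ∀ {n} {p : Subset n} {x} → x ∉ p → (p ∪ ⁅ x ⁆) - x ≡ p
x∉p⇒p∪x-x≡p {p = p} {x} x∉ = ⊆-antisym
  (λ y∈ → y∈p∪x∧y≢x⇒y∈p (x∈p-y⇒x∈p y∈) (x∈p-y⇒x≢y {p = p ∪ ⁅ x ⁆} y∈))
  (λ y∈p → x∈p∧x≢y⇒x∈p-y (p⊆p∪q ⁅ x ⁆ y∈p) λ { refl → x∉ y∈p })

x∉p⇒∣p∪x∣≡suc∣p∣ : ∀ {n} {p : Subset n} {x} → x ∉ p → ∣ p ∪ ⁅ x ⁆ ∣ ≡ suc ∣ p ∣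
x∉p⇒∣p∪x∣≡suc∣p∣ {p = p} {x} x∉ =
  trans (sym (x∈p⇒suc∣p-x∣≡∣p∣ (x∈p∪x p x))) (cong (suc ∘ ∣_∣) (x∉p⇒p∪x-x≡p x∉))

0<∣p∣⇒Nonempty : ∀ {n} {p : Subset n} → 0 < ∣ p ∣ → Nonempty p
0<∣p∣⇒Nonempty {n} {p} 0<p with nonempty? p
... | yes ne = ne
... | no empty = contradiction (subst (λ q → 0 < ∣ q ∣) (Empty-unique empty) 0<p)
                   λ lt → <-irrefl refl (subst (0 <_) (∣⊥∣≡0 n) lt)

∣p∣≡1⇒unique : ∀ {n} {p : Subset n} {x y} → ∣ p ∣ ≡ 1 → x ∈ p → y ∈ p → x ≡ y
∣p∣≡1⇒unique {p = p} {x} {y} eq x∈ y∈ with x ≟ y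
... | yes x≡y = x≡y
... | no x≢y = contradiction (ℕₚ.≤-<-trans z≤n (x∈p⇒∣p-x∣<∣p∣ (x∈p∧x≢y⇒x∈p-y x∈ x≢y)))
                 (subst (λ k → ¬ 0 < k) (sym (∣p-x∣≡ y∈ eq)) λ ())

∃∈p∉q : ∀ {n} {p q : Subset n} {x} → ∣ q ∣ ≤ ∣ p ∣ → x ∈ q → x ∉ p →
  ∃ λ y → y ∈ p × y ∉ q
∃∈p∉q {p = p} {q} {x} q≤p x∈q x∉p with any? (λ y → (y ∈? p) ×-dec ¬? (y ∈? q))
... | yes found = found
... | no none = contradiction (p⊂q⇒∣p∣<∣q∣ (p⊆q , x , x∈q , x∉p)) (ℕₚ.≤⇒≯ q≤p)
  where
  p⊆q : p ⊆ q
  p⊆q {y} y∈p = decidable-stable (y ∈? q) λ y∉q → none (y , y∈p , y∉q)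

p⊆q∧∣q∣≤∣p∣⇒p≡q : ∀ {n} {p q : Subset n} → p ⊆ q → ∣ q ∣ ≤ ∣ p ∣ → p ≡ q
p⊆q∧∣q∣≤∣p∣⇒p≡q {p = p} {q} p⊆q q≤p = ⊆-antisym p⊆q λ {x} x∈q →
  decidable-stable (x ∈? p) λ x∉p → 
    case ∃∈p∉q q≤p x∈q x∉p of λ (y , y∈p , y∉q) → y∉q (p⊆q y∈p)

image : ∀ {k n} → (Fin k → Fin n) → Subset n
image s = comprehension λ w → any? (λ r → s r ≟ w)

∈-image⁺ : ∀ {k n} (s : Fin k → Fin n) r → s r ∈ image s
∈-image⁺ s r = ∈-comprehension⁺ (λ w → any? (λ r → s r ≟ w)) (r , refl)

∈-image⁻ : ∀ {k n} (s : Fin k → Fin n) {w} → w ∈ image s → ∃ λ r → s r ≡ w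
∈-image⁻ s = ∈-comprehension⁻ λ w → any? (λ r → s r ≟ w)

∣image∣ : ∀ {k n} (s : Fin k → Fin n) → Injective _≡_ _≡_ s → ∣ image s ∣ ≡ k
∣image∣ {zero} {n} s _ = trans (cong ∣_∣ (Empty-unique λ (w , w∈) → case ∈-image⁻ s w∈ of λ ())) (∣⊥∣≡0 n)
∣image∣ {suc k} s inj = trans (sym (x∈p⇒suc∣p-x∣≡∣p∣ (∈-image⁺ s zero)))
  (cong suc (trans (cong ∣_∣ rest) (∣image∣ (s ∘ suc) (Finₚ.suc-injective ∘ inj))))
  where
  rest : image s - s zero ≡ image (s ∘ suc)
  rest = ⊆-antisym
    (λ {w} w∈ → case ∈-image⁻ s (x∈p-y⇒x∈p w∈) of λ where
      (zero , eq) → contradiction (sym eq) (x∈p-y⇒x≢y {p = image s} w∈)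
      (suc r , refl) → ∈-image⁺ (s ∘ suc) r)
    (λ {w} w∈ → case ∈-image⁻ (s ∘ suc) w∈ of λ where
      (r , refl) → x∈p∧x≢y⇒x∈p-y (∈-image⁺ s (suc r)) λ eq → case inj eq of λ ())

x∈p⇒0<∣p∣ : ∀ {n} {p : Subset n} {x} → x ∈ p → 0 < ∣ p ∣
x∈p⇒0<∣p∣ x∈ = ≤-<-trans z≤n (x∈p⇒∣p-x∣<∣p∣ x∈)

singleton⇒∣p∣≡1 : ∀ {n} {p : Subset n} {x} → x ∈ p → (∀ {y} → y ∈ p → y ≡ x) → ∣ p ∣ ≡ 1
singleton⇒∣p∣≡1 {p = p} {x} x∈ only = trans
  (cong ∣_∣ (⊆-antisym (λ y∈ → subst (_∈ ⁅ x ⁆) (sym (only y∈)) (x∈⁅x⁆ x))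
                       (λ y∈ → subst (_∈ p) (sym (x∈⁅y⁆⇒x≡y x y∈)) x∈)))
  (∣⁅x⁆∣≡1 x)

indicator≤1 : ∀ {n} (σ : Subset n) i → indicator σ i ≤ 1
indicator≤1 σ i with lookup σ i
... | true = ≤-refl
... | false = z≤n

difference? : ∀ {n} (p q : Subset n) → Decidable (λ x → x ∈ p × x ∉ q)
difference? p q x = (x ∈? p) ×-dec ¬? (x ∈? q)

-- Cycles of a step relation on a finite set.

record Cycle {d} {A : Set} (R : Fin d → A → Fin d → Set) : Set where
  field
    size : ℕ
    vertex : ℕ → Fin d
    label : ℕ → A
    step : ∀ k → R (vertex k) (label k) (vertex (suc k))
    closed : vertex (suc (suc size)) ≡ vertex 0
    distinct : ∀ i j → i < suc (suc size) → j < suc (suc size) → vertex i ≡ vertex j → i ≡ j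

module _ {d} (a : ℕ → Fin d) where

  RepeatsAfter : ℕ → ℕ → Set
  RepeatsAfter p g = 0 < g × a p ≡ a (p + g)

  -- A repetition inside the window of length `g` is a repetition with a smaller gap, so descent on
  -- the gap ends at a window without one.
  shortestRepeat : ∀ p g → Acc _<_ g → RepeatsAfter p g →
    ∃₂ λ q h → RepeatsAfter q h × (∀ i j → i < h → j < h → a (q + i) ≡ a (q + j) → i ≡ j)
  shortestRepeat p g (acc rec) rep
    with any? {n = g} (λ i → any? {n = g} λ j → (toℕ i ℕₚ.<? toℕ j) ×-dec (a (p + toℕ i) ≟ a (p + toℕ j)))
  ... | yes (i , j , i<j , eq) =
    shortestRepeat (p + toℕ i) (toℕ j ∸ toℕ i) (rec (≤-<-trans (ℕₚ.m∸n≤m (toℕ j) (toℕ i)) (toℕ<n j)))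
      ( ℕₚ.m<n⇒0<n∸m i<j
      , trans eq (cong a (sym (trans (ℕₚ.+-assoc p _ _) (cong (p +_) (ℕₚ.m+[n∸m]≡n (ℕₚ.<⇒≤ i<j)))))))
  ... | no none = p , g , rep , distinct
    where
    no-repeat : ∀ i j → i < g → j < g → i < j → a (p + i) ≢ a (p + j)
    no-repeat i j i<g j<g i<j eq = none (fromℕ< i<g , fromℕ< j<g , lemma)
      where
      lemma : toℕ (fromℕ< i<g) < toℕ (fromℕ< j<g) ×
              a (p + toℕ (fromℕ< i<g)) ≡ a (p + toℕ (fromℕ< j<g))
      lemma rewrite toℕ-fromℕ< i<g | toℕ-fromℕ< j<g = i<j , eq
    distinct : ∀ i j → i < g → j < g → a (p + i) ≡ a (p + j) → i ≡ j
    distinct i j i<g j<g eq with ℕₚ.<-cmp i j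
    ... | tri< i<j _ _ = contradiction eq (no-repeat i j i<g j<g i<j)
    ... | tri≈ _ i≡j _ = i≡j
    ... | tri> _ _ j<i = contradiction (sym eq) (no-repeat j i j<g i<g j<i)

module _ {d} {A : Set} {R : Fin d → A → Fin d → Set} (irrefl : ∀ {r l} → ¬ R r l r) where

  closed⇒cycle : (S : Fin d → Set) {r : Fin d} → S r →
    (∀ {r} → S r → ∃₂ λ l r′ → R r l r′ × S r′) → Cycle R
  closed⇒cycle S {r₀} Sr₀ next = fromRepeat repeat
    where
    walk : ℕ → Σ (Fin d) S
    walk zero = r₀ , Sr₀
    walk (suc k) = let (_ , r′ , _ , Sr′) = next (proj₂ (walk k)) in r′ , Sr′
    a : ℕ → Fin d
    a = proj₁ ∘ walk
    label : ℕ → A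
    label k = proj₁ (next (proj₂ (walk k)))
    a-step : ∀ k → R (a k) (label k) (a (suc k))
    a-step k = proj₁ (proj₂ (proj₂ (next (proj₂ (walk k)))))
    repeat : ∃₂ λ p g → RepeatsAfter a p g × (∀ i j → i < g → j < g → a (p + i) ≡ a (p + j) → i ≡ j)
    repeat with i , j , i<j , eq ← Finₚ.pigeonhole (n<1+n d) (a ∘ toℕ) =
      shortestRepeat a (toℕ i) (toℕ j ∸ toℕ i) (<-wellFounded _)
        (ℕₚ.m<n⇒0<n∸m i<j , trans eq (cong a (sym (ℕₚ.m+[n∸m]≡n (ℕₚ.<⇒≤ i<j)))))
    shifted-step : ∀ p k → R (a (p + k)) (label (p + k)) (a (p + suc k))
    shifted-step p k = subst (λ m → R (a (p + k)) (label (p + k)) (a m)) (sym (ℕₚ.+-suc p k)) (a-step (p + k))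
    fromRepeat :
      (∃₂ λ p g → RepeatsAfter a p g × (∀ i j → i < g → j < g → a (p + i) ≡ a (p + j) → i ≡ j)) →
      Cycle R
    fromRepeat (p , zero , (() , _) , _)
    -- A gap of 1 is a step from a vertex to itself; irreflexivity excludes it, which gives the
    -- length of at least 2 built into `Cycle`.
    fromRepeat (p , suc zero , (_ , eq) , _) =
      contradiction (subst (λ r → R (a p) (label p) r) (sym (trans eq (cong a (ℕₚ.+-comm p 1)))) (a-step p)) irrefl
    fromRepeat (p , suc (suc m) , (_ , eq) , distinct) = record
      { size = m
      ; vertex = λ k → a (p + k)
      ; label = λ k → label (p + k)
      ; step = shifted-step p
      ; closed = trans (sym eq) (cong a (sym (ℕₚ.+-identityʳ p)))
      ; distinct = distinct
      }

module _ {n d} {E : EdgeRel n d} where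

  private
    EdgePair : Fin d → Fin n → Fin d → Set
    EdgePair r l r′ = E l r × E l r′

  -- HasCycle lists r_t before the label leading to it, so the cycle is traversed backwards.
  cycle⇒HasCycle : ∀ {R : Fin d → Fin n → Fin d → Set} →
    (∀ {r l r′} → R r l r′ → EdgePair r l r′) →
    (∀ {r s l r′ s′} → R r l r′ → R s l s′ → r ≡ s) → Cycle R → HasCycle E
  cycle⇒HasCycle {R} edges determined C =
    size , (label ∘ back) , (vertex ∘ back) , label-injective , vertex-injective ,
    (λ t → proj₁ (edges (step (back t)))) , shifted , last
    where
    open Cycle C
    back : Fin (suc (suc size)) → ℕ
    back t = toℕ (opposite t)
    vertex-injective : Injective _≡_ _≡_ (vertex ∘ back)
    vertex-injective {s} {t} eq = 
      trans (sym (Finₚ.opposite-involutive s))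
        (trans (cong opposite (Finₚ.toℕ-injective {i = opposite s} {opposite t}
            (distinct _ _ (toℕ<n (opposite s)) (toℕ<n (opposite t)) eq)))
          (Finₚ.opposite-involutive t))
    label-injective : Injective _≡_ _≡_ (label ∘ back)
    label-injective {s} {t} eq =
      vertex-injective (determined {r′ = vertex (suc (back s))} (step (back s))
        (subst (λ l → R (vertex (back t)) l (vertex (suc (back t)))) (sym eq) (step (back t))))
    shifted : ∀ (t : Fin (suc size)) → E (label (back (suc t))) (vertex (back (inject₁ t)))
    shifted t = subst (E (label (back (suc t))) ∘ vertex) (sym back-inject₁) (proj₂ (edges (step (back (suc t)))))
      where
      back-inject₁ : back (inject₁ t) ≡ suc (back (suc t))
      back-inject₁ = trans (Finₚ.opposite-prop (inject₁ t)) (trans (cong (suc size ∸_) (Finₚ.toℕ-inject₁ t))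
        (trans (ℕₚ.+-∸-assoc 1 (Finₚ.toℕ≤pred[n] t)) (cong suc (sym (Finₚ.opposite-prop (suc t))))))
    last : E (label (back zero)) (vertex (back (fromℕ (suc size))))
    last = subst (E (label (back zero))) eq (proj₂ (edges (step (back zero))))
      where
      eq : vertex (suc (back zero)) ≡ vertex (back (fromℕ (suc size)))
      eq = trans (cong (vertex ∘ suc) (Finₚ.toℕ-fromℕ (suc size)))
        (trans closed (cong vertex (sym (trans (Finₚ.opposite-prop (fromℕ (suc size)))
           (trans (cong (suc size ∸_) (Finₚ.toℕ-fromℕ (suc size))) (ℕₚ.n∸n≡0 (suc size)))))))

-- Partial maps, their fibres and the switches between them.

Assignment : ℕ → ℕ → Set
Assignment n d = Fin n → Maybe (Fin d)

module _ {n d : ℕ} where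

  fibre : Assignment n d → Fin d → Subset n
  fibre T r = comprehension λ w → ≡-dec _≟_ (T w) (just r)

  ∈-fibre⁺ : ∀ (T : Assignment n d) {w r} → T w ≡ just r → w ∈ fibre T r
  ∈-fibre⁺ T {r = r} = ∈-comprehension⁺ λ w → ≡-dec _≟_ (T w) (just r)

  ∈-fibre⁻ : ∀ (T : Assignment n d) {w r} → w ∈ fibre T r → T w ≡ just r
  ∈-fibre⁻ T {r = r} = ∈-comprehension⁻ λ w → ≡-dec _≟_ (T w) (just r)

  infix 4 _⊑ₐ_
  _⊑ₐ_ : Assignment n d → Assignment n d → Set
  T ⊑ₐ T′ = ∀ {w r} → T w ≡ just r → T′ w ≡ just r

  single-valued : ∀ (T : Assignment n d) {w r s} → T w ≡ just r → T w ≡ just s → r ≡ s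
  single-valued T eq eq′ = just-injective (trans (sym eq) eq′)

  Switch : Assignment n d → Assignment n d → Fin d → Fin n → Fin d → Set
  Switch T T′ r w r′ = T w ≡ just r × T′ w ≡ just r′ × r′ ≢ r

  -- Acyclicity is stated through closed sets: among finitely many right vertices, a nonempty set
  -- whose members all have a successor inside it contains a cycle. Later arguments then only name a
  -- set and a successor, and shrinking a set replaces surgery on cycles.
  Acyclic : Assignment n d → Assignment n d → Set₁
  Acyclic T T′ = ∀ (S : Fin d → Set) {r} → S r →
    ¬ (∀ {r} → S r → ∃₂ λ w r′ → Switch T T′ r w r′ × S r′)

  Acyclic-⊑ₐ : ∀ {T T′ U U′ : Assignment n d} → U ⊑ₐ T → U′ ⊑ₐ T′ → Acyclic T T′ → Acyclic U U′
  Acyclic-⊑ₐ U⊑T U′⊑T′ ac S Sr next = ac S Sr λ Sr →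
    let (w , r′ , (Uw , U′w , r′≢r) , Sr′) = next Sr in w , r′ , (U⊑T Uw , U′⊑T′ U′w , r′≢r) , Sr′

  module _ (T T′ : Assignment n d) (ac : Acyclic T T′)
           (total : ∀ {w r} → T w ≡ just r → ∃ λ r′ → T′ w ≡ just r′)
           (sizes : ∀ r → ∣ fibre T′ r ∣ ≤ ∣ fibre T r ∣) where

    -- If `w` moves from `r` to `r′`, then `T′` gains `w` over `r′`; since the fibre there does not
    -- grow, it also loses some vertex. So the right vertices that lose a vertex form a closed set.
    acyclic⇒⊑ₐ : T ⊑ₐ T′
    acyclic⇒⊑ₐ {w} {r} Tw with total Tw
    ... | r′ , T′w with r′ ≟ r
    ...   | yes refl = T′w
    ...   | no r′≢r = ⊥-elim (ac (λ r → ∃₂ (Switch T T′ r)) (w , r′ , Tw , T′w , r′≢r) next)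
      where
      next : ∀ {r} → (∃₂ (Switch T T′ r)) → ∃₂ λ w r′ → Switch T T′ r w r′ × ∃₂ (Switch T T′ r′)
      next (w , r′ , sw@(Tw , T′w , r′≢r))
        with ∃∈p∉q (sizes r′) (∈-fibre⁺ T′ T′w) (λ w∈ → r′≢r (single-valued T (∈-fibre⁻ T w∈) Tw))
      ... | u , u∈ , u∉ with total (∈-fibre⁻ T u∈)
      ...   | r″ , T′u = w , r′ , sw , u , r″ , ∈-fibre⁻ T u∈ , T′u , λ { refl → u∉ (∈-fibre⁺ T′ T′u) }

    acyclic⇒⊒ₐ : T′ ⊑ₐ T
    acyclic⇒⊒ₐ {w} {r} T′w = ∈-fibre⁻ T (subst (w ∈_)
      (sym (p⊆q∧∣q∣≤∣p∣⇒p≡q {p = fibre T r} (∈-fibre⁺ T′ ∘ acyclic⇒⊑ₐ ∘ ∈-fibre⁻ T) (sizes r)))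
      (∈-fibre⁺ T′ T′w))

  erase : Assignment n d → Fin n → Assignment n d
  erase T m w with w ≟ m
  ... | yes _ = nothing
  ... | no _ = T w

  erase⁺ : ∀ (T : Assignment n d) {m w r} → T w ≡ just r → w ≢ m → erase T m w ≡ just r
  erase⁺ T {m} {w} Tw w≢m with w ≟ m
  ... | yes w≡m = contradiction w≡m w≢m
  ... | no _ = Tw

  erase⁻ : ∀ (T : Assignment n d) {m w r} → erase T m w ≡ just r → T w ≡ just r × w ≢ m
  erase⁻ T {m} {w} eq with w ≟ m
  ... | no w≢m = eq , w≢m

  fibre-erase : ∀ (T : Assignment n d) m r → fibre (erase T m) r ≡ fibre T r - m
  fibre-erase T m r = ⊆-antisym
    (λ w∈ → let (Tw , w≢m) = erase⁻ T (∈-fibre⁻ (erase T m) w∈) in x∈p∧x≢y⇒x∈p-y (∈-fibre⁺ T Tw) w≢m)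
    (λ w∈ → ∈-fibre⁺ (erase T m) (erase⁺ T (∈-fibre⁻ T (x∈p-y⇒x∈p w∈)) (x∈p-y⇒x≢y {p = fibre T r} w∈)))

  insert : Assignment n d → Fin n → Fin d → Assignment n d
  insert T m c w with w ≟ m
  ... | yes _ = just c
  ... | no _ = T w

  insert-same : ∀ (T : Assignment n d) m c → insert T m c m ≡ just c
  insert-same T m c with m ≟ m
  ... | yes _ = refl
  ... | no m≢m = contradiction refl m≢m

  insert-other : ∀ (T : Assignment n d) {m c w} → w ≢ m → insert T m c w ≡ T w
  insert-other T {m} {w = w} w≢m with w ≟ m
  ... | yes w≡m = contradiction w≡m w≢m
  ... | no _ = refl

lower : ∀ {d} → Fin d → (Fin d → ℕ) → Fin d → ℕ
lower c v = updateAt v c pred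

lower-at : ∀ {d} (c : Fin d) v → lower c v c ≡ pred (v c)
lower-at c v = updateAt-updates c v

lower-away : ∀ {d} {c r : Fin d} v → r ≢ c → lower c v r ≡ v r
lower-away {c = c} {r} v r≢c = updateAt-minimal r c v r≢c

lower-positive : ∀ {d} {c : Fin d} {v} → (∀ r → 0 < v r) → 1 < v c → ∀ r → 0 < lower c v r
lower-positive {c = c} {v} v>0 1<vc r with r ≟ c
... | yes refl = subst (0 <_) (sym (lower-at c v)) (ℕₚ.<⇒≤pred 1<vc)
... | no r≢c = subst (0 <_) (sym (lower-away v r≢c)) (v>0 r)

sumF-lower : ∀ {d} (c : Fin d) v → 0 < v c → suc (sumF (lower c v)) ≡ sumF v
sumF-lower zero v 0<vc with suc k ← v zero = refl
sumF-lower (suc c) v 0<vc =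
  trans (sym (ℕₚ.+-suc (v zero) _)) (cong (v zero +_) (sumF-lower c (v ∘ suc) 0<vc))

0<sumF : ∀ {d} (c : Fin d) v → 0 < v c → 0 < sumF v
0<sumF zero v 0<vc = ℕₚ.<-≤-trans 0<vc (ℕₚ.m≤m+n (v zero) _)
0<sumF (suc c) v 0<vc = ℕₚ.<-≤-trans (0<sumF c (v ∘ suc) 0<vc) (ℕₚ.m≤n+m _ (v zero))

sumF-ones : ∀ {d} (v : Fin d → ℕ) → (∀ r → v r ≡ 1) → sumF v ≡ d
sumF-ones {zero} v _ = refl
sumF-ones {suc d} v v≡1 = cong₂ _+_ (v≡1 zero) (sumF-ones (v ∘ suc) (v≡1 ∘ suc))

∣fibre-erase∣ : ∀ {n d} (T : Assignment n d) {m c} {v : Fin d → ℕ} → T m ≡ just c →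
  (∀ r → ∣ fibre T r ∣ ≡ v r) → ∀ r → ∣ fibre (erase T m) r ∣ ≡ lower c v r
∣fibre-erase∣ T {m} {c} {v} Tm count r with r ≟ c
... | yes refl = trans (cong ∣_∣ (fibre-erase T m c))
  (trans (cong pred (trans (x∈p⇒suc∣p-x∣≡∣p∣ (∈-fibre⁺ T Tm)) (count c))) (sym (lower-at c v)))
... | no r≢c = trans (cong ∣_∣ fibre-unchanged) (trans (count r) (sym (lower-away v r≢c)))
  where
  fibre-unchanged : fibre (erase T m) r ≡ fibre T r
  fibre-unchanged = ⊆-antisym
    (λ w∈ → ∈-fibre⁺ T (proj₁ (erase⁻ T (∈-fibre⁻ (erase T m) w∈))))
    (λ w∈ → ∈-fibre⁺ (erase T m) (erase⁺ T (∈-fibre⁻ T w∈)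
      λ { refl → r≢c (single-valued T (∈-fibre⁻ T w∈) Tm) }))

-- Good topes, deletions and the paths between them.

module Topes {n d : ℕ} (𝓜 : MatchingField n d) where

  Section : (Fin d → Fin n) → Assignment n d → Set
  Section s T = ∀ r → T (s r) ≡ just r

  section-injective : ∀ T {s} → Section s T → Injective _≡_ _≡_ s
  section-injective T {s} sec {q} {r} eq = single-valued T (sec q) (subst (λ w → T w ≡ just r) (sym eq) (sec r))

  -- Equivalent to compatibility with all matchings of 𝓜.
  Good : Assignment n d → Set
  Good T = ∀ s → Section s T → ∀ r → M 𝓜 (image s) (s r) r ≡ true

  Good-⊑ₐ : ∀ {T U} → U ⊑ₐ T → Good T → Good U
  Good-⊑ₐ U⊑T good s sec = good s (U⊑T ∘ sec)

  record Tope (τ : Subset n) (v : Fin d → ℕ) (T : Assignment n d) : Set where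
    field
      defined⇒∈ : ∀ {w r} → T w ≡ just r → w ∈ τ
      ∈⇒defined : ∀ {w} → w ∈ τ → ∃ λ r → T w ≡ just r
      count : ∀ r → ∣ fibre T r ∣ ≡ v r
      good : Good T
  open Tope public

  erase-Tope : ∀ {τ v T m c} → T m ≡ just c → Tope τ v T → Tope (τ - m) (lower c v) (erase T m)
  erase-Tope {T = T} {m} Tm t = record
    { defined⇒∈ = λ eq → let (Tw , w≢m) = erase⁻ T eq in x∈p∧x≢y⇒x∈p-y (defined⇒∈ t Tw) w≢m
    ; ∈⇒defined = λ w∈ → let (r , Tw) = ∈⇒defined t (x∈p-y⇒x∈p w∈) in r , erase⁺ T Tw (x∈p-y⇒x≢y w∈)
    ; count = ∣fibre-erase∣ T Tm (count t)
    ; good = Good-⊑ₐ {T} {erase T m} (proj₁ ∘ erase⁻ T) (good t)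
    }

  fibre-nonempty : ∀ {τ v T} → Tope τ v T → ∀ {r} → 0 < v r → ∃ λ w → T w ≡ just r
  fibre-nonempty {T = T} t {r} 0<vr with 0<∣p∣⇒Nonempty (subst (0 <_) (sym (count t r)) 0<vr)
  ... | w , w∈ = w , ∈-fibre⁻ T w∈

  exchange-element : ∀ {τ τ′ v T T′ w r} → Tope τ v T → Tope τ′ v T′ → T w ≡ just r → T′ w ≢ just r →
    ∃ λ u → T′ u ≡ just r × T u ≢ just r
  exchange-element {T = T} {T′} {r = r} t t′ Tw T′w≢
    with u , u∈ , u∉ ← ∃∈p∉q (ℕₚ.≤-reflexive (trans (count t r) (sym (count t′ r))))
                        (∈-fibre⁺ T Tw) (T′w≢ ∘ ∈-fibre⁻ T′)
    = u , ∈-fibre⁻ T′ u∈ , u∉ ∘ ∈-fibre⁺ T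

  tope-unique : ∀ {τ v T T′} → Tope τ v T → Tope τ v T′ → Acyclic T T′ → T ⊑ₐ T′
  tope-unique {T = T} {T′} t t′ ac = acyclic⇒⊑ₐ T T′ ac (∈⇒defined t′ ∘ defined⇒∈ t)
    λ r → ℕₚ.≤-reflexive (trans (count t′ r) (sym (count t r)))

  record Deletion (τ : Subset n) (v : Fin d → ℕ) (x : Fin n) : Set where
    constructor deletion
    infix 5 _·_
    field
      _·_ : Assignment n d
      removed∈ : x ∈ τ
      tope : Tope (τ - x) v _·_
  open Deletion public

  removed-undefined : ∀ {τ v x} (X : Deletion τ v x) {r} → X · x ≢ just r
  removed-undefined {τ} {x = x} X eq = x∉p-x τ x (defined⇒∈ (tope X) eq)

  erase-Deletion : ∀ {τ v x m c} (X : Deletion τ v x) → X · m ≡ just c → Deletion (τ - m) (lower c v) x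
  erase-Deletion {τ} {v} {x} {m} {c} X Xm = deletion (erase (X ·_) m)
    (x∈p∧x≢y⇒x∈p-y (removed∈ X) λ { refl → removed-undefined X Xm })
    (subst (λ σ → Tope σ (lower c v) (erase (X ·_) m)) (p─x─y≡p─y─x τ x m) (erase-Tope Xm (tope X)))

  -- The map is that of `erase-Deletion`, read as the deletion of `m` from `τ - x` instead of the
  -- deletion of `x` from `τ - m`. These are the two ways in which a deletion enters the invariant
  -- for a smaller type.
  erase-Below : ∀ {τ v x m c} (X : Deletion τ v x) → X · m ≡ just c → Deletion (τ - x) (lower c v) m
  erase-Below X Xm = deletion (erase (X ·_) _) (defined⇒∈ (tope X) Xm) (erase-Tope Xm (tope X))

  -- Says that the fibres over r of all deletions lie in a common set with one element more.
  AtMostOneNew : Subset n → (Fin d → ℕ) → Set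
  AtMostOneNew τ v = ∀ {x y z} (X : Deletion τ v x) (Y : Deletion τ v y) (Z : Deletion τ v z) {w w′ r} →
    Y · w ≡ just r → Z · w′ ≡ just r → X · w ≢ just r → X · w′ ≢ just r → w ≡ w′

  AcyclicDeletions : Subset n → (Fin d → ℕ) → Set₁
  AcyclicDeletions τ v = ∀ {x y} (X : Deletion τ v x) (Y : Deletion τ v y) → Acyclic (X ·_) (Y ·_)

  module Local {τ : Subset n} {v : Fin d → ℕ} (acyclic : AcyclicDeletions τ v) where

    deletion-unique : ∀ {x} (X X′ : Deletion τ v x) → (X ·_) ⊑ₐ (X′ ·_)
    deletion-unique X X′ = tope-unique (tope X) (tope X′) (acyclic X X′)

    -- Without `y` and `x` respectively, both maps are topes of the same type on the same set, hence
    -- equal. Their acyclicity is inherited from `X` and `Y`, since the lowered type may vanish at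
    -- `r`.
    swap-agree : ∀ {x y} (X : Deletion τ v x) (Y : Deletion τ v y) {r} → X · y ≡ just r → Y · x ≡ just r →
      ∀ {w s} → X · w ≡ just s → w ≢ y → Y · w ≡ just s
    swap-agree {x} {y} X Y {r} Xy Yx {w} Xw w≢y = proj₁ (erase⁻ (Y ·_) {x} {w} (agree {w} (erase⁺ (X ·_) Xw w≢y)))
      where
      agree : erase (X ·_) y ⊑ₐ erase (Y ·_) x
      agree {u} = tope-unique (erase-Tope Xy (tope X))
        (subst (λ σ → Tope σ (lower r v) (erase (Y ·_) x)) (p─x─y≡p─y─x τ y x) (erase-Tope Yx (tope Y)))
        (Acyclic-⊑ₐ {T = X ·_} {Y ·_} {erase (X ·_) y} {erase (Y ·_) x}
          (proj₁ ∘ erase⁻ (X ·_)) (proj₁ ∘ erase⁻ (Y ·_)) (acyclic X Y)) {u}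

    Moves : ∀ {x y} → Deletion τ v x → Deletion τ v y → Fin n → Set
    Moves X Y w = ∃₂ λ r r′ → X · w ≡ just r × Y · w ≡ just r′ × r′ ≢ r

    moves? : ∀ {x y} (X : Deletion τ v x) (Y : Deletion τ v y) → Decidable (Moves X Y)
    moves? X Y w with X · w | Y · w
    ... | nothing | _ = no λ { (_ , _ , () , _) }
    ... | just _ | nothing = no λ { (_ , _ , _ , () , _) }
    ... | just r | just r′ with r′ ≟ r
    ...   | yes refl = no λ { (_ , _ , refl , refl , r≢r) → r≢r refl }
    ...   | no r′≢r = yes (r , r′ , refl , refl , r′≢r)

    moves : ∀ {x y} (X : Deletion τ v x) (Y : Deletion τ v y) {w r} →
      w ≢ x → Y · w ≡ just r → X · w ≢ just r → Moves X Y w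
    moves X Y w≢x Yw Xw≢ with ∈⇒defined (tope X) (x∈p∧x≢y⇒x∈p-y (x∈p-y⇒x∈p (defined⇒∈ (tope Y) Yw)) w≢x)
    ... | s , Xw = s , _ , Xw , Yw , λ { refl → Xw≢ Xw }

    module _ (one-new : AtMostOneNew τ v) where

      -- In tree terms: Moves X Y w says that w lies on the path from x to y, so if z lies on the
      -- path from x to y then the path from x to z is an initial piece of it.
      moves-nested : ∀ {x y z} (X : Deletion τ v x) (Y : Deletion τ v y) (Z : Deletion τ v z) →
        Moves X Y z → ∀ {w} → Moves X Z w → Moves X Y w
      moves-nested {z = z} X Y Z (a , a′ , Xz , Yz , a′≢a) {w} mw with moves? X Y w
      ... | yes m = m
      -- The right vertices entered, from `X` to `Z`, by a vertex that does not move between `X` and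
      -- `Y` would form a closed set.
      ... | no ¬m = ⊥-elim (acyclic X Z Stray (w , proj₁ mw , swap mw , ¬m) next)
        where
        Stray : Fin d → Set
        Stray r = ∃₂ λ u s → (Z · u ≡ just r × X · u ≡ just s × r ≢ s) × ¬ Moves X Y u
        swap : (m : Moves X Z w) →
          Z · w ≡ just (proj₁ (proj₂ m)) × X · w ≡ just (proj₁ m) × proj₁ (proj₂ m) ≢ proj₁ m
        swap (_ , _ , Xw , Zw , ≢) = Zw , Xw , ≢
        next : ∀ {r} → Stray r → ∃₂ λ u r′ → Switch (X ·_) (Z ·_) r u r′ × Stray r′
        next {r} (u , s , (Zu , Xu , r≢s) , ¬mu)
          with u′ , Xu′ , Zu′≢ ← exchange-element (tope Z) (tope X) Zu (λ eq → r≢s (single-valued (X ·_) eq Xu))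
          = u′ , proj₁ def , (Xu′ , proj₂ def , λ eq → Zu′≢ (trans (proj₂ def) (cong just eq))) ,
            u′ , r , (proj₂ def , Xu′ , λ eq → Zu′≢ (trans (proj₂ def) (cong just eq))) ,
            λ { (_ , _ , Xu″ , Yu″ , ≢) →
              ≢ (trans (single-valued (Y ·_) Yu″ Yu′) (single-valued (X ·_) Xu′ Xu″)) }
          where
          -- Over `r` the vertex `u` is already new in `Z`. If `Y` lost a vertex of `X` there, it
          -- would gain a new one; by the invariant that is `u`, which does not move between `X` and
          -- `Y`.
          X-fibre⇒Y-fibre : ∀ {t} → X · t ≡ just r → Y · t ≡ just r
          X-fibre⇒Y-fibre {t} Xt = decidable-stable (≡-dec _≟_ (Y · t) (just r)) λ Yt≢ →
            case exchange-element (tope X) (tope Y) Xt Yt≢ of λ (t′ , Yt′ , Xt′≢) →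
            case one-new X Z Y Zu Yt′ (λ eq → r≢s (single-valued (X ·_) eq Xu)) Xt′≢ of λ
              { refl → ¬mu (s , r , Xu , Yt′ , r≢s) }
          Yu′ : Y · u′ ≡ just r
          Yu′ = X-fibre⇒Y-fibre Xu′
          u′≢z : u′ ≢ z
          u′≢z refl = a′≢a (trans (single-valued (Y ·_) Yz Yu′) (single-valued (X ·_) Xu′ Xz))
          def : ∃ λ r′ → Z · u′ ≡ just r′
          def = ∈⇒defined (tope Z) (x∈p∧x≢y⇒x∈p-y (x∈p-y⇒x∈p (defined⇒∈ (tope X) Xu′)) u′≢z)

      -- In tree terms, `z` cannot lie on the path from `x` to `y` while `y` lies on the path from
      -- `x` to `z`: nesting would make `y` move between `X` and `Y`, but `Y` is undefined at `y`.
      not-both-move : ∀ {x y z} (X : Deletion τ v x) (Y : Deletion τ v y) (Z : Deletion τ v z) {r s} →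
        Y · z ≡ just r → X · z ≢ just r → Z · y ≡ just s → X · y ≢ just s → ⊥
      not-both-move {x} {y} {z} X Y Z Yz Xz≢ Zy Xy≢ with z ≟ x | y ≟ x
      ... | yes refl | _ = Xy≢ (deletion-unique Z X Zy)
      ... | no _ | yes refl = Xz≢ (deletion-unique Y X Yz)
      ... | no z≢x | no y≢x
        with _ , _ , _ , Yy , _ ← moves-nested X Y Z (moves X Y z≢x Yz Xz≢) (moves X Z y≢x Zy Xy≢)
        = removed-undefined Y Yy

-- Matchings as topes whose fibres are singletons.

assignment : ∀ {n d} → Graph n d → Assignment n d
assignment G w with any? (λ r → G w r Bool.≟ true)
... | yes (r , _) = just r
... | no _ = nothing

assignment⁻ : ∀ {n d} (G : Graph n d) {w r} → assignment G w ≡ just r → G w r ≡ true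
assignment⁻ G {w} eq with any? (λ r → G w r Bool.≟ true)
assignment⁻ G refl | yes (_ , e) = e

assignment⁺ : ∀ {n d} (G : Graph n d) {w r} →
  G w r ≡ true → (∀ {s} → G w s ≡ true → s ≡ r) → assignment G w ≡ just r
assignment⁺ G {w} {r} e unique with any? (λ r → G w r Bool.≟ true)
... | no none = contradiction (r , e) none
... | yes (_ , e′) = cong just (unique e′)

module Matchings {n d : ℕ} (𝓜 : MatchingField n d) where
  open Topes 𝓜

  match : Subset n → Assignment n d
  match σ = assignment (M 𝓜 σ)

  match⁻ : ∀ {σ w r} → match σ w ≡ just r → M 𝓜 σ w r ≡ true
  match⁻ {σ} = assignment⁻ (M 𝓜 σ)

  match⁺ : ∀ {σ w r} → ∣ σ ∣ ≡ d → M 𝓜 σ w r ≡ true → match σ w ≡ just r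
  match⁺ {σ} {w} {r} size e = assignment⁺ (M 𝓜 σ) e λ e′ →
    ∣p∣≡1⇒unique (proj₁ (proj₂ pm) w (proj₁ (proj₁ pm w r e))) (∈-tabulate⁺ e′) (∈-tabulate⁺ e)
    where pm = isPM 𝓜 σ size

  ones : Fin d → ℕ
  ones _ = 1

  match-Tope : ∀ {σ} → ∣ σ ∣ ≡ d → Tope σ ones (match σ)
  match-Tope {σ} size = record
    { defined⇒∈ = defined⇒∈σ
    ; ∈⇒defined = λ {w} w∈ → case 0<∣p∣⇒Nonempty (subst (0 <_) (sym (proj₁ (proj₂ pm) w w∈)) (s≤s z≤n)) of
        λ (r , r∈) → r , match⁺ size (∈-tabulate⁻ r∈)
    ; count = λ r → trans (cong ∣_∣ (⊆-antisym
        (λ w∈ → ∈-tabulate⁺ (match⁻ {σ} (∈-fibre⁻ (match σ) w∈)))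
        (λ w∈ → ∈-fibre⁺ (match σ) (match⁺ size (∈-tabulate⁻ w∈))))) (proj₂ (proj₂ pm) r ∈⊤)
    ; good = λ s sec r → subst (λ ρ → M 𝓜 ρ (s r) r ≡ true) (sym (image≡σ s sec)) (match⁻ {σ} (sec r))
    }
    where
    pm = isPM 𝓜 σ size
    defined⇒∈σ : ∀ {w r} → match σ w ≡ just r → w ∈ σ
    defined⇒∈σ {w} {r} eq = proj₁ (proj₁ pm w r (match⁻ {σ} eq))
    image≡σ : ∀ s → Section s (match σ) → image s ≡ σ
    image≡σ s sec = p⊆q∧∣q∣≤∣p∣⇒p≡q
      (λ w∈ → case ∈-image⁻ s w∈ of λ { (r , refl) → defined⇒∈σ (sec r) })
      (ℕₚ.≤-reflexive (trans size (sym (∣image∣ s (section-injective (match σ) sec)))))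

  good⇒match : ∀ T {s} → Good T → Section s T → ∀ r → match (image s) (s r) ≡ just r
  good⇒match T {s} good sec r = match⁺ (∣image∣ s (section-injective T sec)) (good s sec r)

  fibre-unique : ∀ {σ T} → Tope σ ones T → ∀ {w w′ r} → T w ≡ just r → T w′ ≡ just r → w ≡ w′
  fibre-unique {T = T} t {r = r} Tw Tw′ = ∣p∣≡1⇒unique (count t r) (∈-fibre⁺ T Tw) (∈-fibre⁺ T Tw′)

  -- Singleton fibres leave one choice of section; its image has `d` elements, so it is all of `σ`,
  -- and goodness identifies the section with `M_σ`.
  tope⊑match : ∀ {σ T} → ∣ σ ∣ ≡ d → Tope σ ones T → T ⊑ₐ match σ
  tope⊑match {σ} {T} size t {w} {r} Tw =
    subst (λ u → match σ u ≡ just r) (fibre-unique t (section r) Tw)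
      (subst (λ ρ → match ρ (s r) ≡ just r) image≡σ (good⇒match T (good t) section r))
    where
    s : Fin d → Fin n
    s r = proj₁ (fibre-nonempty t {r} (s≤s z≤n))
    section : Section s T
    section r = proj₂ (fibre-nonempty t (s≤s z≤n))
    image≡σ : image s ≡ σ
    image≡σ = p⊆q∧∣q∣≤∣p∣⇒p≡q
      (λ w∈ → case ∈-image⁻ s w∈ of λ { (r , refl) → defined⇒∈ t (section r) })
      (ℕₚ.≤-reflexive (trans size (sym (∣image∣ s (section-injective T section)))))

  Union : Subset n → EdgeRel n d
  Union τ w r = Σ (Subset n) λ σ → σ ⊆ τ × ∣ σ ∣ ≡ d × M 𝓜 σ w r ≡ true

  module _ {τ : Subset n} (size : ∣ τ ∣ ≡ suc d) where

    matchDeletion : ∀ {x} → x ∈ τ → Deletion τ ones x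
    matchDeletion {x} x∈ = deletion (match (τ - x)) x∈ (match-Tope (∣p-x∣≡ x∈ size))

    deletion-edge : ∀ {x} (X : Deletion τ ones x) {w r} → X · w ≡ just r → Union τ w r
    deletion-edge {x} X {w} {r} Xw = τ - x , p─q⊆p τ ⁅ x ⁆ , size′ , match⁻ {τ - x} (tope⊑match size′ (tope X) Xw)
      where size′ = ∣p-x∣≡ (removed∈ X) size

  -- Linkage trees and acyclicity between arbitrary matchings.

  module Linked (linkage : IsLinkage 𝓜) where

    module Base {τ : Subset n} (size : ∣ τ ∣ ≡ suc d) where

      -- Each step leaves along an edge of `X` and arrives along any edge of the tree. The first
      -- edge determines the source from the label, so distinct right vertices on the resulting
      -- cycle come with distinct left vertices.
      no-closed-walk : ∀ {x} (X : Deletion τ ones x) (S : Fin d → Set) {r} → S r →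
        ¬ (∀ {r} → S r → ∃₂ λ w r′ → (X · w ≡ just r × Union τ w r′ × r′ ≢ r) × S r′)
      no-closed-walk X S Sr next = proj₂ (proj₂ (linkage τ size)) 
        (cycle⇒HasCycle {R = λ r w r′ → X · w ≡ just r × Union τ w r′ × r′ ≢ r}
          (λ (Xw , e , _) → deletion-edge size X Xw , e)
          (λ (Xw , _) (Xw′ , _) → single-valued (X ·_) Xw Xw′)
          (closed⇒cycle (λ (_ , _ , r≢r) → r≢r refl) S Sr next))

      acyclic : AcyclicDeletions τ ones
      acyclic X Y S Sr next = no-closed-walk X S Sr λ Sr →
        let (w , r′ , (Xw , Yw , r′≢r) , Sr′) = next Sr in w , r′ , (Xw , deletion-edge size Y Yw , r′≢r) , Sr′

      open Local acyclic public

      -- Otherwise, alternating from j between Z and Y ends at y, and the edge between y and j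
      -- closes a cycle in the tree.
      matched-across-edge : ∀ {y z} (Y : Deletion τ ones y) (Z : Deletion τ ones z) {j k} →
        Union τ y j → Z · k ≡ just j → k ≢ y → Y · k ≡ just j
      matched-across-edge {y} {z} Y Z {j} {k} edge Zk k≢y = decidable-stable (≡-dec _≟_ (Y · k) (just j)) λ Yk≢ →
        no-closed-walk Z Differ (k , Zk , Yk≢) (next (k , Zk , Yk≢))
        where
        Differ : Fin d → Set
        Differ r = ∃ λ w → Z · w ≡ just r × Y · w ≢ just r
        next : Differ j → ∀ {r} → Differ r → ∃₂ λ w r′ → (Z · w ≡ just r × Union τ w r′ × r′ ≢ r) × Differ r′
        next differ {r} (w , Zw , Yw≢) with w ≟ y
        ... | yes refl = w , j , (Zw , edge , λ { refl → k≢y (fibre-unique (tope Z) Zk Zw) }) , differ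
        ... | no w≢y with ∈⇒defined (tope Y) (x∈p∧x≢y⇒x∈p-y (x∈p-y⇒x∈p (defined⇒∈ (tope Z) Zw)) w≢y)
        ...   | r′ , Yw with fibre-nonempty (tope Z) {r′} (s≤s z≤n)
        ...     | u , Zu = w , r′ , (Zw , deletion-edge size Y Yw , r′≢r) , u , Zu ,
          λ Yu → r′≢r (single-valued (Z ·_) (subst (λ t → Z · t ≡ just r′) (fibre-unique (tope Y) Yu Yw) Zu) Zw)
          where
          r′≢r : r′ ≢ r
          r′≢r refl = Yw≢ Yw

      -- Let `m` be the partner of `r` in `X`. Both `w` and `w′` differ from `m`, so the tree edge
      -- from `m` to `r` makes each of them the partner of `r` in the deletion of `m`.
      one-new : AtMostOneNew τ ones
      one-new X Y Z {w} {w′} {r} Yw Zw′ Xw≢ Xw′≢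
        with m , Xm ← fibre-nonempty (tope X) {r} (s≤s z≤n)
        = fibre-unique (tope N) (matched-across-edge N Y edge Yw λ { refl → Xw≢ Xm })
                                (matched-across-edge N Z edge Zw′ λ { refl → Xw′≢ Xm })
        where
        N : Deletion τ ones m
        N = matchDeletion size (x∈p-y⇒x∈p (defined⇒∈ (tope X) Xm))
        edge : Union τ m r
        edge = deletion-edge size X Xm

      module _ {x : Fin n} (X : Deletion τ ones x) (A : Subset n) (A⊆τ : A ⊆ τ) where

        private
          Goal : Set
          Goal = ∃ λ a → Σ (a ∈ A) λ a∈ → ∀ {b} → b ∈ A → ¬ Moves X (matchDeletion size (A⊆τ a∈)) b

        -- The element of A closest to x in the tree.
        first-in : ∀ {a} (a∈ : a ∈ A) →
          Acc _<_ ∣ comprehension (moves? X (matchDeletion size (A⊆τ a∈))) ∣ → Goal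
        first-in {a} a∈ (acc rec) = byCases (any? (λ b → (b ∈? A) ×-dec moves? X Dₐ b))
          where
          Dₐ : Deletion τ ones a
          Dₐ = matchDeletion size (A⊆τ a∈)
          byCases : Dec (∃ λ b → b ∈ A × Moves X Dₐ b) → Goal
          byCases (no none) = a , a∈ , λ b∈ m → none (_ , b∈ , m)
          -- Passing from `a` to `b` shrinks the set of moving vertices: nesting gives inclusion,
          -- and `b` itself drops out.
          byCases (yes (b , b∈ , m)) = first-in b∈ (rec (p⊂q⇒∣p∣<∣q∣
            ( (λ w∈ → ∈-comprehension⁺ (moves? X Dₐ)
                (moves-nested one-new X Dₐ D_b m (∈-comprehension⁻ (moves? X D_b) w∈)))
            , b , ∈-comprehension⁺ (moves? X Dₐ) m
            , λ b∈ → case ∈-comprehension⁻ (moves? X D_b) b∈ of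
                λ (_ , _ , _ , eq , _) → removed-undefined D_b eq)))
            where
            D_b : Deletion τ ones b
            D_b = matchDeletion size (A⊆τ b∈)

    -- Induction on the part of `σ′` outside `σ`. A vertex `i` of `σ` is added to `σ′`, and the
    -- vertex `b` of that part nearest to `i` in the resulting tree is removed. If `b` was the only
    -- one, `M_σ′` itself supplies the edge; otherwise induction applies to `τ - b`.
    exchange : ∀ {σ σ′ a} → ∣ σ ∣ ≡ d → ∣ σ′ ∣ ≡ d → a ∈ σ′ → a ∉ σ →
      Acc _<_ ∣ comprehension (difference? σ′ σ) ∣ →
      ∃₂ λ i j → i ∈ σ′ × i ∉ σ × match σ′ i ≡ just j × Union (σ ∪ ⁅ i ⁆) i j
    exchange {σ} {σ′} size size′ a∈ a∉ (acc rec) =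
      fromMissing (∃∈p∉q {p = σ} {σ′} (ℕₚ.≤-reflexive (trans size′ (sym size))) a∈ a∉)
      where
      A = comprehension (difference? σ′ σ)
      Result = ∃₂ λ i j → i ∈ σ′ × i ∉ σ × match σ′ i ≡ just j × Union (σ ∪ ⁅ i ⁆) i j
      fromMissing : (∃ λ i → i ∈ σ × i ∉ σ′) → Result
      fromMissing (i , i∈σ , i∉σ′) =
        fromFirst (first-in X A A⊆τ (∈-comprehension⁺ (difference? σ′ σ) (a∈ , a∉)) (<-wellFounded _))
        where
        τ = σ′ ∪ ⁅ i ⁆
        sizeτ : ∣ τ ∣ ≡ suc d
        sizeτ = trans (x∉p⇒∣p∪x∣≡suc∣p∣ i∉σ′) (cong suc size′)
        open Base {τ} sizeτ
        X = matchDeletion sizeτ (x∈p∪x σ′ i)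
        A⊆τ : A ⊆ τ
        A⊆τ = p⊆p∪q ⁅ i ⁆ ∘ proj₁ ∘ ∈-comprehension⁻ (difference? σ′ σ)
        ∈τ⇒∈σ′ : ∀ {c} → c ∈ τ → c ∉ σ → c ∈ σ′
        ∈τ⇒∈σ′ c∈ c∉ = y∈p∪x∧y≢x⇒y∈p c∈ λ { refl → c∉ i∈σ }
        fromFirst :
          (∃ λ b → Σ (b ∈ A) λ b∈ → ∀ {c} → c ∈ A → ¬ Moves X (matchDeletion sizeτ (A⊆τ b∈)) c) → Result
        fromFirst (b , b∈ , fixed)
          with any? (difference? (τ - b) σ) | ∈-comprehension⁻ (difference? σ′ σ) b∈
        ... | no none | b∈σ′ , b∉σ with ∈⇒defined (match-Tope size′) b∈σ′
        ...   | j , eq = b , j , b∈σ′ , b∉σ , eq , σ′ , σ′⊆σ∪b , size′ , match⁻ {σ′} eq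
          where
          σ′⊆σ∪b : σ′ ⊆ σ ∪ ⁅ b ⁆
          σ′⊆σ∪b {c} c∈ with c ≟ b
          ... | yes refl = x∈p∪x σ b
          ... | no c≢b = p⊆p∪q ⁅ b ⁆ (decidable-stable (c ∈? σ)
            λ c∉ → none (c , x∈p∧x≢y⇒x∈p-y (p⊆p∪q ⁅ i ⁆ c∈) c≢b , c∉))
        fromFirst (b , b∈ , fixed) | yes (c , c∈ , c∉) | b∈σ′ , b∉σ
          with k , j , k∈ , k∉ , eq , edge ← exchange size (∣p-x∣≡ (A⊆τ b∈) sizeτ) c∈ c∉ (rec (p⊂q⇒∣p∣<∣q∣
            ( (λ c∈ → let (c∈τ-b , c∉) = ∈-comprehension⁻ (difference? (τ - b) σ) c∈
                      in ∈-comprehension⁺ (difference? σ′ σ) (∈τ⇒∈σ′ (x∈p-y⇒x∈p c∈τ-b) c∉ , c∉))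
            , b , b∈
            , λ b∈ → x∉p-x τ b (proj₁ (∈-comprehension⁻ (difference? (τ - b) σ) b∈)))))
          = k , j , k∈σ′ , k∉ , subst (λ ρ → match ρ k ≡ just j) (x∉p⇒p∪x-x≡p i∉σ′) Xk , edge
          where
          k∈σ′ : k ∈ σ′
          k∈σ′ = ∈τ⇒∈σ′ (x∈p-y⇒x∈p k∈) k∉
          -- The edge found belongs to the matching of `τ - b`. As `b` is nearest to `i`, no vertex
          -- of `σ′` outside `σ` moves between that matching and `M_σ′`, so `k` has the same partner
          -- in both.
          Xk : X · k ≡ just j
          Xk = decidable-stable (≡-dec _≟_ (X · k) (just j)) λ Xk≢ →
            fixed (∈-comprehension⁺ (difference? σ′ σ) (k∈σ′ , k∉))
              (moves X (matchDeletion sizeτ (A⊆τ b∈)) (λ { refl → i∉σ′ k∈σ′ }) eq Xk≢)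

    private
      disagree? : ∀ σ σ′ → Decidable (λ w → w ∈ σ′ × match σ w ≢ match σ′ w)
      disagree? σ σ′ w = (w ∈? σ′) ×-dec ¬? (≡-dec _≟_ (match σ w) (match σ′ w))

    -- The vertex k entering σ was not in σ, so no step of a closed set S leads to the right
    -- vertex j that k takes over, and S without j is still closed.
    match-acyclic : ∀ {σ σ′} → ∣ σ ∣ ≡ d → ∣ σ′ ∣ ≡ d → Acc _<_ ∣ comprehension (disagree? σ σ′) ∣ →
      Acyclic (match σ) (match σ′)
    match-acyclic {σ} {σ′} size size′ (acc rec) S {r} Sr next = byCases (any? (difference? σ′ σ))
      where
      unequal : ∃₂ (λ i j → i ∈ σ′ × i ∉ σ × match σ′ i ≡ just j × Union (σ ∪ ⁅ i ⁆) i j) → ⊥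
      byCases : Dec (∃ λ a → a ∈ σ′ × a ∉ σ) → ⊥
      byCases (yes (a , a∈ , a∉)) = unequal (exchange size size′ a∈ a∉ (<-wellFounded _))
      byCases (no none) = let (w , r′ , (σw , σ′w , r′≢r) , _) = next Sr in
        r′≢r (single-valued (match σ) (subst (λ ρ → match ρ w ≡ just r′) σ′≡σ σ′w) σw)
        where
        σ′≡σ : σ′ ≡ σ
        σ′≡σ = p⊆q∧∣q∣≤∣p∣⇒p≡q (λ {w} w∈ → decidable-stable (w ∈? σ) λ w∉ → none (w , w∈ , w∉))
          (ℕₚ.≤-reflexive (trans size (sym size′)))
      unequal (k , j , k∈ , k∉ , σ′k , edge) = descend (fibre-nonempty (match-Tope size) (s≤s z≤n))
        where
        τ = σ ∪ ⁅ k ⁆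
        sizeτ : ∣ τ ∣ ≡ suc d
        sizeτ = trans (x∉p⇒∣p∪x∣≡suc∣p∣ k∉) (cong suc size)
        open Base {τ} sizeτ
        X : Deletion τ ones k
        X = matchDeletion sizeτ (x∈p∪x σ k)
        σ⇒X : ∀ {w s} → match σ w ≡ just s → X · w ≡ just s
        σ⇒X {w} {s} = subst (λ ρ → match ρ w ≡ just s) (sym (x∉p⇒p∪x-x≡p k∉))
        σk≢ : ∀ {s} → match σ k ≢ just s
        σk≢ eq = k∉ (defined⇒∈ (match-Tope size) eq)
        descend : (∃ λ i → match σ i ≡ just j) → ⊥
        -- Replacing `i`, the partner of `j`, by `k` creates agreement with `σ′` at `k` and keeps
        -- all other partners, so there are fewer disagreements.
        descend (i , σi) = match-acyclic {τ - i} {σ′} (∣p-x∣≡ i∈τ sizeτ) size′ (rec smaller)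
          (λ r → S r × r ≢ j) (proj₂ (start (r ≟ j))) next′
          where
          i∈τ : i ∈ τ
          i∈τ = p⊆p∪q ⁅ k ⁆ (defined⇒∈ (match-Tope size) σi)
          Y : Deletion τ ones i
          Y = matchDeletion sizeτ i∈τ
          -- If `Y` covered `j` by some `u` other than `k`, the tree edge from `k` to `j` would put
          -- `u` over `j` in `X` as well, so `u` would be the removed vertex `i`.
          Yk : Y · k ≡ just j
          Yk = let (u , Yu) = fibre-nonempty (tope Y) (s≤s z≤n) in
            subst (λ w → Y · w ≡ just j) (decidable-stable (u ≟ k) λ u≢k →
              removed-undefined Y (subst (λ w → Y · w ≡ just j)
                (fibre-unique (tope X) (matched-across-edge X Y edge Yu u≢k) (σ⇒X σi)) Yu)) Yu
          σ⇒Y : ∀ {w s} → match σ w ≡ just s → w ≢ i → Y · w ≡ just s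
          σ⇒Y eq = swap-agree X Y (σ⇒X σi) Yk (σ⇒X eq)
          still : ∀ {w} → w ∈ σ′ → Y · w ≢ match σ′ w → Dec (w ≡ i) → match σ w ≢ match σ′ w
          still {w} w∈ Y≢ (no w≢i) eq = let (s , σ′w) = ∈⇒defined (match-Tope size′) w∈ in
            Y≢ (trans (σ⇒Y (trans eq σ′w) w≢i) (sym σ′w))
          -- Should `i` lie in `σ′`, it was a disagreement before: being matched to `j` in `σ′` too
          -- would force `i = k`.
          still {w} w∈ Y≢ (yes refl) eq = σk≢ (subst (λ w → match σ w ≡ just j)
            (fibre-unique (match-Tope size′) (trans (sym eq) σi) σ′k) σi)
          smaller : ∣ comprehension (disagree? (τ - i) σ′) ∣ < ∣ comprehension (disagree? σ σ′) ∣
          smaller = p⊂q⇒∣p∣<∣q∣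
            ( (λ w∈ → let (w∈σ′ , ≢) = ∈-comprehension⁻ (disagree? (τ - i) σ′) w∈ in
                      ∈-comprehension⁺ (disagree? σ σ′) (w∈σ′ , still w∈σ′ ≢ (_ ≟ i)))
            , k , ∈-comprehension⁺ (disagree? σ σ′) (k∈ , λ eq → σk≢ (trans eq σ′k))
            , λ k∈ → proj₂ (∈-comprehension⁻ (disagree? (τ - i) σ′) k∈) (trans Yk (sym σ′k)) )
          start : Dec (r ≡ j) → ∃ λ r → S r × r ≢ j
          start (no r≢j) = r , Sr , r≢j
          start (yes refl) = let (_ , r′ , (_ , _ , r′≢r) , Sr′) = next Sr in r′ , Sr′ , r′≢r
          next′ : ∀ {r} → S r × r ≢ j → ∃₂ λ w r′ → Switch (match (τ - i)) (match σ′) r w r′ × (S r′ × r′ ≢ j)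
          next′ (Sr , r≢j) = let (w , r′ , (σw , σ′w , r′≢r) , Sr′) = next Sr in
            w , r′ , (σ⇒Y σw (λ { refl → r≢j (single-valued (match σ) σw σi) }) , σ′w , r′≢r) , Sr′ ,
            λ { refl → σk≢ (subst (λ w → match σ w ≡ just _) (fibre-unique (match-Tope size′) σ′w σ′k) σw) }

    -- A cycle between T and T′ has at most one left vertex in each fibre of T or T′, so it extends
    -- to a section of T and to one of T′, and becomes a cycle between two matchings of 𝓜.
    no-cycle : ∀ T T′ → Good T → Good T′ →
      (∀ r → ∃ λ w → T w ≡ just r) → (∀ r → ∃ λ w → T′ w ≡ just r) → ¬ Cycle (Switch T T′)
    no-cycle T T′ good good′ onto onto′ C =
      match-acyclic (∣image∣ s′ (section-injective T′ section′)) (∣image∣ s (section-injective T section))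
        (<-wellFounded _) OnCycle (zero , refl) cyclic
      where
      open Cycle C
      OnCycle : Fin d → Set
      OnCycle r = ∃ λ (k : Fin (suc (suc size))) → vertex (suc (toℕ k)) ≡ r
      onCycle? : ∀ r → Dec (OnCycle r)
      onCycle? r = any? λ k → vertex (suc (toℕ k)) ≟ r
      source? : ∀ r → Dec (∃ λ (k : Fin (suc (suc size))) → vertex (toℕ k) ≡ r)
      source? r = any? λ k → vertex (toℕ k) ≟ r
      choose : ∀ {r} → Dec (∃ λ (k : Fin (suc (suc size))) → vertex (toℕ k) ≡ r) → Fin n
      choose (yes (k , _)) = label (toℕ k)
      choose {r} (no _) = proj₁ (onto r)
      choose′ : ∀ {r} → Dec (OnCycle r) → Fin n
      choose′ (yes (k , _)) = label (toℕ k)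
      choose′ {r} (no _) = proj₁ (onto′ r)
      s s′ : Fin d → Fin n
      s r = choose (source? r)
      s′ r = choose′ (onCycle? r)
      section : Section s T
      section r with source? r
      ... | yes (k , refl) = proj₁ (step (toℕ k))
      ... | no _ = proj₂ (onto r)
      section′ : Section s′ T′
      section′ r with onCycle? r
      ... | yes (k , refl) = proj₁ (proj₂ (step (toℕ k)))
      ... | no _ = proj₂ (onto′ r)
      s-vertex : ∀ (k : Fin (suc (suc size))) → s (vertex (toℕ k)) ≡ label (toℕ k)
      s-vertex k with source? (vertex (toℕ k))
      ... | yes (l , eq) = cong label (distinct _ _ (toℕ<n l) (toℕ<n k) eq)
      ... | no none = contradiction (k , refl) none
      s′-onCycle : ∀ {r} → OnCycle r →
        ∃ λ (k : Fin (suc (suc size))) → vertex (suc (toℕ k)) ≡ r × s′ r ≡ label (toℕ k)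
      s′-onCycle {r} on with onCycle? r
      ... | yes (k , eq) = k , eq , refl
      ... | no none = contradiction on none
      vertex-onCycle : ∀ (k : Fin (suc (suc size))) → OnCycle (vertex (toℕ k))
      vertex-onCycle zero = fromℕ (suc size) , trans (cong (vertex ∘ suc) (Finₚ.toℕ-fromℕ (suc size))) closed
      vertex-onCycle (suc k) = inject₁ k , cong (vertex ∘ suc) (Finₚ.toℕ-inject₁ k)
      -- The cycle is walked backwards, from `vertex (suc k)` to `vertex k`, so `distinct` is needed
      -- only at indices where it is given and the closing equation only in `vertex-onCycle`.
      cyclic : ∀ {r} → OnCycle r → ∃₂ λ w r′ → Switch (match (image s′)) (match (image s)) r w r′ × OnCycle r′
      cyclic {r} on = let (k , eq , s′r) = s′-onCycle on in
        label (toℕ k) , vertex (toℕ k) ,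
        ( subst (λ w → match (image s′) w ≡ just r) s′r (good⇒match T′ good′ section′ r)
        , subst (λ w → match (image s) w ≡ just (vertex (toℕ k))) (s-vertex k)
            (good⇒match T good section (vertex (toℕ k)))
        , λ eq′ → proj₂ (proj₂ (step (toℕ k))) (trans eq (sym eq′)) ) ,
        vertex-onCycle k

    good-acyclic : ∀ T T′ → Good T → Good T′ →
      (∀ r → ∃ λ w → T w ≡ just r) → (∀ r → ∃ λ w → T′ w ≡ just r) → Acyclic T T′
    good-acyclic T T′ good good′ onto onto′ S Sr next =
      no-cycle T T′ good good′ onto onto′ (closed⇒cycle (λ (_ , _ , r≢r) → r≢r refl) S Sr next)

    -- The induction step: enlarging one fibre.

    Positive : (Fin d → ℕ) → Set
    Positive v = ∀ r → 0 < v r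

    acyclicDeletions : ∀ {τ v} → Positive v → AcyclicDeletions τ v
    acyclicDeletions v>0 X Y = good-acyclic (X ·_) (Y ·_) (good (tope X)) (good (tope Y))
      (λ r → fibre-nonempty (tope X) (v>0 r)) (λ r → fibre-nonempty (tope Y) (v>0 r))

    HasTopes : ℕ → Set
    HasTopes k = ∀ τ v → ∣ τ ∣ ≡ k → Positive v → sumF v ≡ k → ∃ (Tope τ v)

    OneNew : ℕ → Set
    OneNew k = ∀ τ v → ∣ τ ∣ ≡ suc k → Positive v → sumF v ≡ k → AtMostOneNew τ v

    module Step {k : ℕ} (topes : HasTopes k) (one-new : OneNew k)
                {v : Fin d → ℕ} (v>0 : Positive v) (sum≡ : sumF v ≡ suc k) {c : Fin d} (1<vc : 1 < v c) where

      u : Fin d → ℕ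
      u = lower c v

      u>0 : Positive u
      u>0 = lower-positive v>0 1<vc

      sum-u : sumF u ≡ k
      sum-u = ℕₚ.suc-injective (trans (sumF-lower c v (v>0 c)) sum≡)

      delete : ∀ {ρ} → ∣ ρ ∣ ≡ suc k → ∀ {x} → x ∈ ρ → Deletion ρ u x
      delete {ρ} size {x} x∈ = let (T , t) = topes (ρ - x) u (∣p-x∣≡ x∈ size) u>0 sum-u in deletion T x∈ t

      module Insert {τ : Subset n} {y : Fin n} (Y : Deletion τ u y) where

        W : Assignment n d
        W = insert (Y ·_) y c

        Wy : W y ≡ just c
        Wy = insert-same (Y ·_) y c

        W⇒Y : ∀ {w r} → W w ≡ just r → w ≢ y → Y · w ≡ just r
        W⇒Y Ww w≢y = trans (sym (insert-other (Y ·_) w≢y)) Ww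

        Y⇒≢y : ∀ {w r} → Y · w ≡ just r → w ≢ y
        Y⇒≢y Yw refl = removed-undefined Y Yw

        Y⇒W : ∀ {w r} → Y · w ≡ just r → W w ≡ just r
        Y⇒W Yw = trans (insert-other (Y ·_) (Y⇒≢y Yw)) Yw

        W-fibre-y : ∀ {r} → W y ≡ just r → r ≡ c
        W-fibre-y Wy′ = single-valued W {y} Wy′ Wy

        defined : ∀ {w r} → W w ≡ just r → w ∈ τ
        defined {w} Ww with w ≟ y
        ... | yes refl = removed∈ Y
        ... | no _ = x∈p-y⇒x∈p (defined⇒∈ (tope Y) Ww)

        total : ∀ {w} → w ∈ τ → ∃ λ r → W w ≡ just r
        total {w} w∈ with w ≟ y
        ... | yes _ = c , refl
        ... | no w≢y = ∈⇒defined (tope Y) (x∈p∧x≢y⇒x∈p-y w∈ w≢y)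

        counted : ∀ r → ∣ fibre W r ∣ ≡ v r
        counted r with r ≟ c
        ... | yes refl = trans (sym (x∈p⇒suc∣p-x∣≡∣p∣ (∈-fibre⁺ W Wy)))
          (trans (cong suc (trans (cong ∣_∣ fibre-W-y) (trans (count (tope Y) c) (lower-at c v))))
            (ℕₚ.suc-pred (v c) {{>-nonZero (v>0 c)}}))
          where
          fibre-W-y : fibre W c - y ≡ fibre (Y ·_) c
          fibre-W-y = ⊆-antisym
            (λ w∈ → ∈-fibre⁺ (Y ·_) (W⇒Y (∈-fibre⁻ W (x∈p-y⇒x∈p w∈)) (x∈p-y⇒x≢y {p = fibre W c} w∈)))
            (λ w∈ → x∈p∧x≢y⇒x∈p-y (∈-fibre⁺ W (Y⇒W (∈-fibre⁻ (Y ·_) w∈))) (Y⇒≢y (∈-fibre⁻ (Y ·_) w∈)))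
        ... | no r≢c = trans (cong ∣_∣ (⊆-antisym
            (λ w∈ → ∈-fibre⁺ (Y ·_) (W⇒Y (∈-fibre⁻ W w∈) λ { refl → r≢c (W-fibre-y (∈-fibre⁻ W w∈)) }))
            (λ w∈ → ∈-fibre⁺ W (Y⇒W (∈-fibre⁻ (Y ·_) w∈)))))
          (trans (count (tope Y) r) (lower-away v r≢c))

        -- A section of W through y misses z, and W agrees with Z away from z.
        W-good : ∀ {z} (Z : Deletion τ u z) → Y · z ≡ just c → Z · y ≡ just c → Good W
        W-good {z} Z Yz Zy s sec = byCases (s c ≟ y)
          where
          meets-y : ∀ {r} → s r ≡ y → r ≡ c
          meets-y {r} sr≡y = W-fibre-y (subst (λ w → W w ≡ just r) sr≡y (sec r))
          through-y : s c ≡ y → ∀ r → Dec (r ≡ c) → Z · s r ≡ just r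
          through-y sc≡y r (yes refl) = subst (λ w → Z · w ≡ just c) (sym sc≡y) Zy
          through-y sc≡y r (no r≢c) = Local.swap-agree (acyclicDeletions u>0) Y Z Yz Zy Ysr
            (λ sr≡z → r≢c (single-valued (Y ·_) Ysr (subst (λ w → Y · w ≡ just c) (sym sr≡z) Yz)))
            where
            Ysr : Y · s r ≡ just r
            Ysr = W⇒Y (sec r) (r≢c ∘ meets-y)
          byCases : Dec (s c ≡ y) → ∀ r → M 𝓜 (image s) (s r) r ≡ true
          byCases (no sc≢y) = good (tope Y) s λ r → W⇒Y (sec r) λ sr≡y →
            sc≢y (subst (λ q → s q ≡ y) (meets-y sr≡y) sr≡y)
          byCases (yes sc≡y) = good (tope Z) s λ r → through-y sc≡y r (r ≟ c)

        W-tope : Good W → Tope τ v W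
        W-tope W-good = record { defined⇒∈ = defined ; ∈⇒defined = total ; count = counted ; good = W-good }

      -- Relative to `Y`, the deletion `Z` has lost `z` over `c` and so has a new vertex there.
      -- Since `X` has the new vertex `y`, the invariant makes it `y`. Thus `Y` and `Z` exchange `y`
      -- and `z` over `c`, as `W-good` requires.
      insert-between : ∀ {τ x y z} → ∣ τ ∣ ≡ suc k →
        (X : Deletion τ u x) (Y : Deletion τ u y) (Z : Deletion τ u z) →
        X · y ≡ just c → Y · z ≡ just c → ∃ (Tope τ v)
      insert-between {τ} {y = y} size X Y Z Xy Yz = W , W-tope (W-good Z Yz Zy)
        where
        open Insert Y
        Zy : Z · y ≡ just c
        Zy = let (t , Zt , Yt≢) = exchange-element (tope Y) (tope Z) Yz (removed-undefined Z) in
          subst (λ w → Z · w ≡ just c)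
            (one-new τ u size u>0 sum-u Y Z X Zt Xy Yt≢ (removed-undefined Y)) Zt

      extend : ∀ τ → ∣ τ ∣ ≡ suc k → ∃ (Tope τ v)
      extend τ size = fromX (delete size (proj₂ (0<∣p∣⇒Nonempty (subst (0 <_) (sym size) (s≤s z≤n)))))
        where
        ∈τ : ∀ {x w r} (X : Deletion τ u x) → X · w ≡ just r → w ∈ τ
        ∈τ X Xw = x∈p-y⇒x∈p (defined⇒∈ (tope X) Xw)
        fromXY : ∀ {x y} (X : Deletion τ u x) → X · y ≡ just c → Deletion τ u y → ∃ (Tope τ v)
        fromXY X Xy Y = let (z , Yz) = fibre-nonempty (tope Y) (u>0 c) in
          insert-between size X Y (delete size (∈τ Y Yz)) Xy Yz
        fromX : ∀ {x} → Deletion τ u x → ∃ (Tope τ v)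
        fromX X = let (y , Xy) = fibre-nonempty (tope X) (u>0 c) in fromXY X Xy (delete size (∈τ X Xy))

      -- Inheritance of the invariant by the larger type.

      module Below {τ : Subset n} (size : ∣ τ ∣ ≡ suc (suc k)) (topes⁺ : HasTopes (suc k)) where

        size-minus : ∀ {x} → x ∈ τ → ∣ τ - x ∣ ≡ suc k
        size-minus x∈ = ∣p-x∣≡ x∈ size

        one-new-below : ∀ {x} → x ∈ τ → AtMostOneNew (τ - x) u
        one-new-below {x} x∈ = one-new (τ - x) u (size-minus x∈) u>0 sum-u

        transpose : ∀ {x y} → x ∈ τ → Deletion (τ - x) u y → Deletion (τ - y) u x
        transpose {x} {y} x∈ U = deletion (U ·_)
          (x∈p∧x≢y⇒x∈p-y x∈ λ { refl → x∉p-x τ y (removed∈ U) })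
          (subst (λ σ → Tope σ u (U ·_)) (p─x─y≡p─y─x τ x y) (tope U))

        via-common : ∀ {x y z m} (X : Deletion τ v x) (Y : Deletion τ v y) (Z : Deletion τ v z) →
          X · m ≡ just c → Y · m ≡ just c → Z · m ≡ just c → ∀ {w w′ r} →
          Y · w ≡ just r → Z · w′ ≡ just r → X · w ≢ just r → X · w′ ≢ just r → w ≡ w′
        via-common {m = m} X Y Z Xm Ym Zm Yw Zw′ Xw≢ Xw′≢ =
          one-new-below (x∈p-y⇒x∈p (defined⇒∈ (tope X) Xm))
            (erase-Deletion X Xm) (erase-Deletion Y Ym) (erase-Deletion Z Zm)
            (erase⁺ (Y ·_) Yw λ { refl → Xw≢ (trans Xm (trans (sym Ym) Yw)) })
            (erase⁺ (Z ·_) Zw′ λ { refl → Xw′≢ (trans Xm (trans (sym Zm) Zw′)) })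
            (Xw≢ ∘ proj₁ ∘ erase⁻ (X ·_)) (Xw′≢ ∘ proj₁ ∘ erase⁻ (X ·_))

        another : ∀ {x m} (X : Deletion τ v x) → X · m ≡ just c → ∃ λ m′ → X · m′ ≡ just c × m′ ≢ m
        another {m = m} X Xm = let (m′ , eq) = fibre-nonempty (tope (erase-Below X Xm)) (u>0 c) in
          m′ , erase⁻ (X ·_) {m} {m′} eq

        -- The fibre of `X` over `c` is the common set of the invariant on `τ - x`. It has two
        -- vertices `m` and `m′`; relative to `X` without `m`, the vertex `m` is new in `X` without
        -- `m′`, so a further new `p` in `U` would be `m`.
        below⊆ : ∀ {x y p} (X : Deletion τ v x) (U : Deletion (τ - x) u y) → U · p ≡ just c → X · p ≡ just c
        below⊆ {p = p} X U Up = decidable-stable (≡-dec _≟_ (X · p) (just c)) λ Xp≢ →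
          let (m , Xm) = fibre-nonempty (tope X) (v>0 c)
              (m′ , Xm′ , m′≢m) = another X Xm
              p≡m = one-new-below (removed∈ X) (erase-Below X Xm) U (erase-Below X Xm′)
                      Up (erase⁺ (X ·_) Xm (m′≢m ∘ sym)) (Xp≢ ∘ proj₁ ∘ erase⁻ (X ·_))
                      (removed-undefined (erase-Below X Xm))
          in Xp≢ (subst (λ w → X · w ≡ just c) (sym p≡m) Xm)

        between : ∀ {x y} → Deletion τ v x → Deletion τ v y → y ≢ x → Deletion (τ - x) u y
        between X Y y≢x = delete (size-minus (removed∈ X)) (x∈p∧x≢y⇒x∈p-y (removed∈ Y) y≢x)

        -- A tope of the smaller type `u` on `τ` without `x` and `y` lies below both over `c`, and
        -- its fibre there is nonempty.
        common : ∀ {x y} (X : Deletion τ v x) (Y : Deletion τ v y) → y ≢ x →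
          ∃ λ m → X · m ≡ just c × Y · m ≡ just c
        common X Y y≢x =
          let U = between X Y y≢x
              (m , Um) = fibre-nonempty (tope U) (u>0 c)
          in m , below⊆ X U Um , below⊆ Y (transpose (removed∈ X) U) Um

        one-new-pair : ∀ {x y} (X : Deletion τ v x) (Y : Deletion τ v y) → ∀ {w w′ r} →
          Y · w ≡ just r → Y · w′ ≡ just r → X · w ≢ just r → X · w′ ≢ just r → w ≡ w′
        one-new-pair {x} {y} X Y {w} {w′} {r} Yw Yw′ Xw≢ Xw′≢ = byCases Y Yw Yw′ (y ≟ x)
          where
          byCases : ∀ {y} (Y : Deletion τ v y) → Y · w ≡ just r → Y · w′ ≡ just r → Dec (y ≡ x) → w ≡ w′
          byCases Y Yw Yw′ (yes refl) = contradiction (Local.deletion-unique (acyclicDeletions v>0) Y X Yw) Xw≢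
          byCases Y Yw Yw′ (no y≢x) = let (m , Xm , Ym) = common X Y y≢x in
            via-common X Y Y Xm Ym Ym Yw Yw′ Xw≢ Xw′≢

        -- `X` without `b` contains `a` over `c`, and `X` without `a` contains `b`; if `P` missed
        -- both, they would be two new vertices.
        misses-one : ∀ {x a b q} (X : Deletion τ v x) → X · a ≡ just c → X · b ≡ just c → a ≢ b →
          (P : Deletion (τ - x) u q) → P · a ≢ just c → ¬ P · b ≢ just c
        misses-one X Xa Xb a≢b P Pa≢ Pb≢ = a≢b (one-new-below (removed∈ X)
          P (erase-Below X Xb) (erase-Below X Xa)
          (erase⁺ (X ·_) Xa a≢b) (erase⁺ (X ·_) Xb (a≢b ∘ sym)) Pa≢ Pb≢)

        -- In tree terms, `m` lies on the path from `p` to `a`, where `X` without `a` serves as the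
        -- deletion of `a`. So `a` does not lie on the path from `p` to `m`.
        still-missed : ∀ {x a m p j} (X : Deletion τ v x) → X · a ≡ just c → X · m ≡ just j → j ≢ c →
          (U : Deletion (τ - x) u p) (P : Deletion (τ - x) u m) →
          U · m ≢ just j → U · a ≢ just c → P · a ≢ just c
        still-missed X Xa Xm j≢c U P Um≢ Ua≢ Pa =
          Local.not-both-move (acyclicDeletions u>0) (one-new-below (removed∈ X)) U (erase-Below X Xa) P
            (erase⁺ (X ·_) Xm λ { refl → j≢c (single-valued (X ·_) Xm Xa) }) Um≢ Pa Ua≢

        -- If `V` also took `m` away from `j`, the deletion of `m` would miss both `a` and `b` over
        -- `c`.
        moved-alike : ∀ {x a b m p q j} (X : Deletion τ v x) → X · a ≡ just c → X · b ≡ just c → a ≢ b →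
          X · m ≡ just j → j ≢ c → (U : Deletion (τ - x) u p) (V : Deletion (τ - x) u q) →
          U · a ≢ just c → V · b ≢ just c → U · m ≢ just j → V · m ≡ just j
        moved-alike {m = m} {j = j} X Xa Xb a≢b Xm j≢c U V Ua≢ Vb≢ Um≢ =
          decidable-stable (≡-dec _≟_ (V · m) (just j)) λ Vm≢ →
            let P = delete (size-minus (removed∈ X)) (defined⇒∈ (tope X) Xm) in
            misses-one X Xa Xb a≢b P
              (still-missed X Xa Xm j≢c U P Um≢ Ua≢) (still-missed X Xb Xm j≢c V P Vm≢ Vb≢)

        -- X, Y and Z pairwise share a left vertex over c (a, b and e), but no left vertex is
        -- shared by all three, so deleting one does not reduce the claim to type u.
        module Triple {x y z a b e : Fin n} {j : Fin d}
                      (X : Deletion τ v x) (Y : Deletion τ v y) (Z : Deletion τ v z)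
                      (Xa : X · a ≡ just c) (Za : Z · a ≡ just c) (Ya≢ : Y · a ≢ just c)
                      (Xb : X · b ≡ just c) (Zb≢ : Z · b ≢ just c)
                      (Ze : Z · e ≡ just c) (Xe≢ : X · e ≢ just c)
                      (j≢c : j ≢ c) (Xy : X · y ≡ just j) (Zy≢ : Z · y ≢ just j)
                      (XY : Deletion (τ - x) u y) (XZ : Deletion (τ - x) u z) (ZY : Deletion (τ - z) u y) where

          private
            ZX : Deletion (τ - z) u x
            ZX = transpose (removed∈ X) XZ

            missed : ∀ {p q w} (P : Deletion τ v p) (Q : Deletion τ v q) (PQ : Deletion (τ - p) u q) →
              Q · w ≢ just c → PQ · w ≢ just c
            missed P Q PQ Qw≢ PQw = Qw≢ (below⊆ Q (transpose (removed∈ P) PQ) PQw)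

            -- `XY` misses `a` and lacks `y`; since `XZ` misses `b`, it must keep `y` over `j`.
            XZy : XZ · y ≡ just j
            XZy = moved-alike X Xa Xb (λ { refl → Zb≢ Za }) Xy j≢c XY XZ
              (missed X Y XY Ya≢) (missed X Z XZ Zb≢) (removed-undefined XY)

            a≢e : a ≢ e
            a≢e refl = Xe≢ Xa

            a≢y : a ≢ y
            a≢y refl = j≢c (single-valued (X ·_) Xy Xa)

            Z-moved : ∃ λ m → Z · m ≡ just j × ZX · m ≢ just j
            Z-moved = let (m , Zm , ZXm≢) = exchange-element (tope ZX) (tope (erase-Below Z Za)) XZy
                            (Zy≢ ∘ proj₁ ∘ erase⁻ (Z ·_))
                      in m , proj₁ (erase⁻ (Z ·_) Zm) , ZXm≢

            -- `P` misses `e` because `ZX` does and has taken `m` away from `j`. It also misses `a`: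
            -- `P` and `ZY` exchange `y` and `m` over `j`, so they agree at `a`, which `ZY` misses.
            -- Missing both is one too many.
            impossible : ∀ {m} → Z · m ≡ just j → ZX · m ≢ just j → Deletion (τ - z) u m → ⊥
            impossible {m} Zm ZXm≢ P = misses-one Z Za Ze a≢e P Pa≢ Pe≢
              where
              ZYm : ZY · m ≡ just j
              ZYm = moved-alike Z Ze Za (a≢e ∘ sym) Zm j≢c ZX ZY
                (missed Z X ZX Xe≢) (missed Z Y ZY Ya≢) ZXm≢
              Pe≢ : P · e ≢ just c
              Pe≢ = still-missed Z Ze Zm j≢c ZX P ZXm≢ (missed Z X ZX Xe≢)
              Py : P · y ≡ just j
              Py = decidable-stable (≡-dec _≟_ (P · y) (just j)) λ Py≢ →
                Zy≢ (subst (λ w → Z · w ≡ just j)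
                  (sym (one-new-below (removed∈ Z) P ZX (erase-Below Z Ze) XZy
                    (erase⁺ (Z ·_) Zm λ { refl → j≢c (single-valued (Z ·_) Zm Ze) })
                    Py≢ (removed-undefined P))) Zm)
              Pa≢ : P · a ≢ just c
              Pa≢ Pa = missed Z Y ZY Ya≢ (Local.swap-agree (acyclicDeletions u>0) P ZY Py ZYm Pa a≢y)

          no-triple : ⊥
          no-triple = let (m , Zm , ZXm≢) = Z-moved in
            impossible Zm ZXm≢ (delete (size-minus (removed∈ Z)) (defined⇒∈ (tope Z) Zm))

        -- The counterpart of `matched-across-edge` for larger types. If it failed, `y` in `X` and
        -- `w` in `Z` would be two new vertices relative to `Y`; a vertex over `c` common to all
        -- three reduces this to type `u`, and `Triple` handles the rest.
        neighbour-fibre : ∀ {x y z w j} (X : Deletion τ v x) (Y : Deletion τ v y) (Z : Deletion τ v z) →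
          X · y ≡ just j → Z · w ≡ just j → w ≢ y → Y · w ≡ just j
        neighbour-fibre {x} {y} {z} {w} {j} X Y Z Xy Zw w≢y =
          decidable-stable (≡-dec _≟_ (Y · w) (just j)) λ Yw≢ → byCases Yw≢ Z Zw (z ≟ x) (z ≟ y)
          where
          Yy≢ : Y · y ≢ just j
          Yy≢ = removed-undefined Y
          y≢x : y ≢ x
          y≢x refl = removed-undefined X Xy
          byCases : Y · w ≢ just j → ∀ {z} (Z : Deletion τ v z) → Z · w ≡ just j → Dec (z ≡ x) → Dec (z ≡ y) → ⊥
          byCases Yw≢ Z Zw (yes refl) _ =
            w≢y (one-new-pair Y X (Local.deletion-unique (acyclicDeletions v>0) Z X Zw) Xy Yw≢ Yy≢)
          byCases Yw≢ Z Zw (no _) (yes refl) = Yw≢ (Local.deletion-unique (acyclicDeletions v>0) Z Y Zw)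
          byCases Yw≢ {z} Z Zw (no z≢x) (no z≢y) =
            let (a , Xa , Za) = common X Z z≢x
                (b , Xb , Yb) = common X Y y≢x
                (e , Ze , Ye) = common Z Y (z≢y ∘ sym)
            in distinctCommon Xa Za Xb Yb Ze Ye
                 (≡-dec _≟_ (Y · a) (just c)) (≡-dec _≟_ (Z · b) (just c)) (≡-dec _≟_ (X · e) (just c))
                 (j ≟ c) (≡-dec _≟_ (Z · y) (just j))
            where
            no-common : ∀ {m} → X · m ≡ just c → Y · m ≡ just c → Z · m ≡ just c → ⊥
            no-common Xm Ym Zm = w≢y (via-common Y Z X Ym Zm Xm Zw Xy Yw≢ Yy≢)
            distinctCommon : ∀ {a b e} → X · a ≡ just c → Z · a ≡ just c → X · b ≡ just c → Y · b ≡ just c →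
              Z · e ≡ just c → Y · e ≡ just c →
              Dec (Y · a ≡ just c) → Dec (Z · b ≡ just c) → Dec (X · e ≡ just c) →
              Dec (j ≡ c) → Dec (Z · y ≡ just j) → ⊥
            distinctCommon Xa Za Xb Yb Ze Ye (yes Ya) _ _ _ _ = no-common Xa Ya Za
            distinctCommon Xa Za Xb Yb Ze Ye _ (yes Zb) _ _ _ = no-common Xb Yb Zb
            distinctCommon Xa Za Xb Yb Ze Ye _ _ (yes Xe) _ _ = no-common Xe Ye Ze
            -- Over `c` itself, relative to `Y`, both `w` and `a` are new in `Z`, and both `a` and
            -- `y` are new in `X`; the pair case identifies them all.
            distinctCommon Xa Za Xb Yb Ze Ye (no Ya≢) _ _ (yes refl) _ =
              w≢y (trans (one-new-pair Y Z Zw Za Yw≢ Ya≢) (one-new-pair Y X Xa Xy Ya≢ Yy≢))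
            distinctCommon Xa Za Xb Yb Ze Ye _ _ _ _ (yes Zy) = w≢y (one-new-pair Y Z Zw Zy Yw≢ Yy≢)
            distinctCommon Xa Za Xb Yb Ze Ye (no Ya≢) (no Zb≢) (no Xe≢) (no j≢c) (no Zy≢) =
              Triple.no-triple X Y Z Xa Za Ya≢ Xb Zb≢ Ze Xe≢ j≢c Xy Zy≢
                (between X Y y≢x) (between X Z z≢x) (between Z Y (z≢y ∘ sym))

        -- As for `v = 1`, both vertices are carried into the deletion `N` of a vertex of `X` over
        -- `r`, where the pair case applies. `N` has the full type `v`, so existence at this size
        -- has to precede the invariant.
        one-new⁺ : AtMostOneNew τ v
        one-new⁺ X Y Z {w} {w′} {r} Yw Zw′ Xw≢ Xw′≢ =
          let (y , Xy) = fibre-nonempty (tope X) (v>0 r)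
              y∈τ = x∈p-y⇒x∈p (defined⇒∈ (tope X) Xy)
              (T , t) = topes⁺ (τ - y) v (size-minus y∈τ) v>0 sum≡
              N = deletion T y∈τ t
          in one-new-pair X N
               (neighbour-fibre X N Y Xy Yw λ { refl → Xw≢ Xy })
               (neighbour-fibre X N Z Xy Zw′ λ { refl → Xw′≢ Xy })
               Xw≢ Xw′≢

    -- The simultaneous induction on the size of the type.

    retype : ∀ {τ v v′ T} → (∀ r → v r ≡ v′ r) → Tope τ v T → Tope τ v′ T
    retype v≡v′ t = record
      { defined⇒∈ = defined⇒∈ t
      ; ∈⇒defined = ∈⇒defined t
      ; count = λ r → trans (count t r) (v≡v′ r)
      ; good = good t
      }

    retype-Deletion : ∀ {τ v v′ x} → (∀ r → v r ≡ v′ r) → Deletion τ v x → Deletion τ v′ x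
    retype-Deletion v≡v′ X = deletion (X ·_) (removed∈ X) (retype v≡v′ (tope X))

    ones? : ∀ {v : Fin d → ℕ} → Positive v → ¬ (∃ λ c → 1 < v c) → ∀ r → v r ≡ 1
    ones? v>0 none r = ℕₚ.≤-antisym (ℕₚ.≮⇒≥ λ 1<vr → none (r , 1<vr)) (v>0 r)

    one<? : ∀ (v : Fin d → ℕ) → Dec (∃ λ (c : Fin d) → 1 < v c)
    one<? v = any? λ c → 1 ℕₚ.<? v c

    sumF≢0 : ∀ {v : Fin d → ℕ} {c : Fin d} → Positive v → sumF v ≢ 0
    sumF≢0 {v} {c} v>0 eq = <-irrefl (sym eq) (0<sumF c v (v>0 c))

    hasTopes : ∀ k → HasTopes k
    oneNew : ∀ k → OneNew k

    hasTopes k τ v size v>0 sum≡ = byCases k size sum≡ (one<? v)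
      where
      byCases : ∀ k → ∣ τ ∣ ≡ k → sumF v ≡ k → Dec (∃ λ c → 1 < v c) → ∃ (Tope τ v)
      -- The base case is the all-ones type, at whatever `k` it occurs, so it is tested before `k`
      -- is split.
      byCases k size sum≡ (no none) =
        match τ , retype (λ r → sym (v≡1 r)) (match-Tope (trans size (trans (sym sum≡) (sumF-ones v v≡1))))
        where v≡1 = ones? v>0 none
      byCases zero size sum≡ (yes (c , _)) = contradiction sum≡ (sumF≢0 {c = c} v>0)
      byCases (suc k) size sum≡ (yes (c , 1<vc)) = Step.extend (hasTopes k) (oneNew k) v>0 sum≡ 1<vc τ size

    oneNew k τ v size v>0 sum≡ = byCases k size sum≡ (one<? v)
      where
      byCases : ∀ k → ∣ τ ∣ ≡ suc k → sumF v ≡ k → Dec (∃ λ c → 1 < v c) → AtMostOneNew τ v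
      byCases k size sum≡ (no none) X Y Z = Base.one-new
        (trans size (cong suc (trans (sym sum≡) (sumF-ones v v≡1))))
        (retype-Deletion v≡1 X) (retype-Deletion v≡1 Y) (retype-Deletion v≡1 Z)
        where v≡1 = ones? v>0 none
      byCases zero size sum≡ (yes (c , _)) = contradiction sum≡ (sumF≢0 {c = c} v>0)
      byCases (suc k) size sum≡ (yes (c , 1<vc)) =
        Step.Below.one-new⁺ (hasTopes k) (oneNew k) v>0 sum≡ 1<vc size (hasTopes (suc k))

    -- Back to graphs: compatibility and uniqueness.

    toGraph : Assignment n d → Graph n d
    toGraph T w r = does (≡-dec _≟_ (T w) (just r))

    toGraph⁺ : ∀ T {w r} → T w ≡ just r → toGraph T w r ≡ true
    toGraph⁺ T {w} {r} Tw = dec-true (≡-dec _≟_ (T w) (just r)) Tw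

    toGraph⁻ : ∀ T {w r} → toGraph T w r ≡ true → T w ≡ just r
    toGraph⁻ T e = ∈-fibre⁻ T (∈-tabulate⁺ e)

    degL-toGraph : ∀ T {w r} → T w ≡ just r → degL (toGraph T) w ≡ 1
    degL-toGraph T {w} Tw = singleton⇒∣p∣≡1 (∈-tabulate⁺ (toGraph⁺ T Tw))
      λ s∈ → single-valued T (toGraph⁻ T (∈-tabulate⁻ s∈)) Tw

    module PerfectMatching {J : Subset n} {I : Subset d} {H : Graph n d} (pm : IsPerfectMatchingOn J I H) where

      left∈ : ∀ {i j} → H i j ≡ true → i ∈ J
      left∈ e = proj₁ (proj₁ pm _ _ e)

      right∈ : ∀ {i j} → H i j ≡ true → j ∈ I
      right∈ e = proj₂ (proj₁ pm _ _ e)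

      right-unique : ∀ {i j j′} → H i j ≡ true → H i j′ ≡ true → j ≡ j′
      right-unique e e′ = ∣p∣≡1⇒unique (proj₁ (proj₂ pm) _ (left∈ e)) (∈-tabulate⁺ e) (∈-tabulate⁺ e′)

      left-unique : ∀ {i i′ j} → H i j ≡ true → H i′ j ≡ true → i ≡ i′
      left-unique {j = j} e e′ = ∣p∣≡1⇒unique (proj₂ (proj₂ pm) j (right∈ e))
        (∈-tabulate⁺ {f = λ i → H i j} e) (∈-tabulate⁺ {f = λ i → H i j} e′)

      right-exists : ∀ {i} → i ∈ J → ∃ λ j → H i j ≡ true
      right-exists i∈ = let (j , j∈) = 0<∣p∣⇒Nonempty (subst (0 <_) (sym (proj₁ (proj₂ pm) _ i∈)) (s≤s z≤n)) in
        j , ∈-tabulate⁻ j∈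

      left-exists : ∀ {j} → j ∈ I → ∃ λ i → H i j ≡ true
      left-exists j∈ = let (i , i∈) = 0<∣p∣⇒Nonempty (subst (0 <_) (sym (proj₂ (proj₂ pm) _ j∈)) (s≤s z≤n)) in
        i , ∈-tabulate⁻ i∈

    -- Two perfect matchings on the same vertices that differ at `r` also differ at the right vertex
    -- to which the second one sends the `H₁`-partner of `r`, so the places of difference form a
    -- closed set.
    acyclic⇒compatible : ∀ {T σ} → ∣ σ ∣ ≡ d → Acyclic T (match σ) → Compatible (toGraph T) (M 𝓜 σ)
    acyclic⇒compatible {T} {σ} size ac J I H₁ H₂ H₁⊑ pm₁ H₂⊑ pm₂ i j = Bool.⇔→≡ (mk⇔ H₁⇒H₂ H₂⇒H₁)
      where
      module P₁ = PerfectMatching pm₁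
      module P₂ = PerfectMatching pm₂
      Differ : Fin d → Set
      Differ r = ∃ λ w → H₁ w r ≡ true × H₂ w r ≢ true
      next : ∀ {r} → Differ r → ∃₂ λ w r′ → Switch T (match σ) r w r′ × Differ r′
      next (w , e₁ , ¬e₂) =
        let (r′ , e₂) = P₂.right-exists (P₁.left∈ e₁)
            (w′ , e₁′) = P₁.left-exists (P₂.right∈ e₂)
            r′≢r = λ eq → ¬e₂ (subst (λ q → H₂ w q ≡ true) eq e₂)
        in w , r′ , (toGraph⁻ T (H₁⊑ _ _ e₁) , match⁺ size (H₂⊑ _ _ e₂) , r′≢r) , w′ , e₁′ ,
           λ e₂′ → r′≢r (P₁.right-unique (subst (λ u → H₁ u r′ ≡ true) (P₂.left-unique e₂′ e₂) e₁′) e₁)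
      H₁⇒H₂ : ∀ {i j} → H₁ i j ≡ true → H₂ i j ≡ true
      H₁⇒H₂ {i} {j} e₁ = decidable-stable (H₂ i j Bool.≟ true) λ ¬e₂ → ac Differ (i , e₁ , ¬e₂) next
      H₂⇒H₁ : ∀ {i j} → H₂ i j ≡ true → H₁ i j ≡ true
      H₂⇒H₁ {i} {j} e₂ = let (j′ , e₁) = P₁.right-exists (P₂.left∈ e₂) in
        subst (λ r → H₁ i r ≡ true) (P₂.right-unique (H₁⇒H₂ e₁) e₂) e₁

    -- A section, seen as a graph, is a perfect matching inside `G` on `image s` and all of `R`;
    -- compatibility equates it with the matching of the field there.
    compatible⇒good : ∀ {G} → CompatibleWithAll 𝓜 G → Good (assignment G)
    compatible⇒good {G} compatible s section r = trans (sym
      (compatible (image s) size (image s) ⊤ H (M 𝓜 (image s)) H⊑G pm (λ _ _ e → e)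
        (isPM 𝓜 (image s) size) (s r) r))
      (dec-true (s r ≟ s r) refl)
      where
      size : ∣ image s ∣ ≡ d
      size = ∣image∣ s (section-injective (assignment G) section)
      H : Graph n d
      H i j = does (s j ≟ i)
      H⁺ : ∀ {i j} → s j ≡ i → H i j ≡ true
      H⁺ {i} {j} eq = dec-true (s j ≟ i) eq
      H⁻ : ∀ {i j} → H i j ≡ true → s j ≡ i
      H⁻ {i} {j} e = ∈-comprehension⁻ (λ j → s j ≟ i) (∈-tabulate⁺ e)
      H⊑G : H ⊑ G
      H⊑G i j e = subst (λ w → G w j ≡ true) (H⁻ e) (assignment⁻ G (section j))
      pm : IsPerfectMatchingOn (image s) ⊤ H
      pm = (λ i j e → subst (_∈ image s) (H⁻ e) (∈-image⁺ s j) , ∈⊤)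
         , (λ i i∈ → let (q , eq) = ∈-image⁻ s i∈ in singleton⇒∣p∣≡1 (∈-tabulate⁺ (H⁺ eq))
              λ {j} j∈ → section-injective (assignment G) section (trans (H⁻ {i} {j} (∈-tabulate⁻ j∈)) (sym eq)))
         , λ j _ → singleton⇒∣p∣≡1 {x = s j} (∈-tabulate⁺ {f = λ i → H i j} (H⁺ {s j} {j} refl))
              λ i∈ → sym (H⁻ (∈-tabulate⁻ {f = λ i → H i j} i∈))

    module Unique {v : Fin d → ℕ} {T : Assignment n d} (v>0 : Positive v) (t : Tope ⊤ v T)
                  {G : Graph n d} (isTope : IsTope G)
                  (degR≡ : ∀ r → degR G r ≡ v r) (compatible : CompatibleWithAll 𝓜 G) where

      A : Assignment n d
      A = assignment G

      degL≤1 : ∀ i → degL G i ≤ 1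
      degL≤1 i = subst (_≤ 1) (sym (proj₁ (proj₂ isTope) i)) (indicator≤1 (proj₁ isTope) i)

      A⁺ : ∀ {w r} → G w r ≡ true → A w ≡ just r
      A⁺ {w} e = assignment⁺ G e λ e′ →
        ∣p∣≡1⇒unique (ℕₚ.≤-antisym (degL≤1 w) (x∈p⇒0<∣p∣ (∈-tabulate⁺ {f = G w} e)))
          (∈-tabulate⁺ e′) (∈-tabulate⁺ e)

      fibre-A : ∀ r → ∣ fibre A r ∣ ≡ v r
      fibre-A r = trans (cong ∣_∣ (⊆-antisym
        (λ w∈ → ∈-tabulate⁺ {f = λ i → G i r} (assignment⁻ G (∈-fibre⁻ A w∈)))
        (λ w∈ → ∈-fibre⁺ A (A⁺ (∈-tabulate⁻ {f = λ i → G i r} w∈))))) (degR≡ r)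

      A-onto : ∀ r → ∃ λ w → A w ≡ just r
      A-onto r = let (w , w∈) = 0<∣p∣⇒Nonempty (subst (0 <_) (sym (fibre-A r)) (v>0 r)) in w , ∈-fibre⁻ A w∈

      A-acyclic : Acyclic A T
      A-acyclic = good-acyclic A T (compatible⇒good {G} compatible) (good t)
        A-onto (λ r → fibre-nonempty t (v>0 r))

      sizes : ∀ r → ∣ fibre T r ∣ ≤ ∣ fibre A r ∣
      sizes r = ℕₚ.≤-reflexive (trans (count t r) (sym (fibre-A r)))

      -- Since `T` is defined on all of `L`, acyclicity gives `A ⊑ₐ T`, and equal fibre sizes turn
      -- this into equality; in particular `G` is then maximal.
      unique : ∀ i j → G i j ≡ toGraph T i j
      unique i j = Bool.⇔→≡ (mk⇔
        (λ e → toGraph⁺ T (acyclic⇒⊑ₐ A T A-acyclic (λ _ → ∈⇒defined t ∈⊤) sizes (A⁺ e)))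
        (λ e → assignment⁻ G (acyclic⇒⊒ₐ A T A-acyclic (λ _ → ∈⇒defined t ∈⊤) sizes (toGraph⁻ T e))))

theorem3p16 : (n d : ℕ) → 0 < d → d ≤ n →
    (𝓜 : MatchingField n d) → IsLinkage 𝓜 →
    (v : Fin d → ℕ) → (∀ j → 0 < v j) → sumF v ≡ n →
    Σ (Graph n d) λ T →
    IsMaximalTope T × (∀ j → degR T j ≡ v j) × CompatibleWithAll 𝓜 T ×
    (∀ (T′ : Graph n d) → IsTope T′ → (∀ j → degR T′ j ≡ v j) →
    CompatibleWithAll 𝓜 T′ → ∀ i j → T′ i j ≡ T i j)
theorem3p16 n d _ _ 𝓜 linkage v v>0 sum≡ =
  toGraph T , (degL≡1 , degR>0) , count t , compatible , λ G → Unique.unique v>0 t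
  where
  open Topes 𝓜
  open Matchings 𝓜
  open Linked linkage
  tope-on-⊤ : ∃ (Tope ⊤ v)
  tope-on-⊤ = hasTopes n ⊤ v (∣⊤∣≡n n) v>0 sum≡
  T = proj₁ tope-on-⊤
  t = proj₂ tope-on-⊤
  degL≡1 : ∀ i → degL (toGraph T) i ≡ indicator ⊤ i
  degL≡1 i = trans (degL-toGraph T {i} (proj₂ (∈⇒defined t {i} ∈⊤)))
    (cong (λ b → if b then 1 else 0) (sym (lookup-replicate i inside)))
  degR>0 : ∀ j → 0 < degR (toGraph T) j
  degR>0 j = subst (0 <_) (sym (count t j)) (v>0 j)
  compatible : CompatibleWithAll 𝓜 (toGraph T)
  compatible σ size = acyclic⇒compatible size (good-acyclic T (match σ) (good t) (good (match-Tope size))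
    (λ r → fibre-nonempty t (v>0 r)) (λ r → fibre-nonempty (match-Tope size) (s≤s z≤n)))
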